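{- For each positive integer $n$, let $$G_n(x)=(x-1)^2+2^{ -2^{n+1}},$$ a univariate polynomial. Then: (i) the subtraction-free complexity of $G_n(x)$ is finite and is greater than $2^n$; (ii) the ordinary arithmetic circuit complexity of $G_n(x)$ is $O(1)$ if arbitrary constants are allowed as inputs; (iii) if $1$ is the only input constant allowed, the ordinary arithmetic circuit complexity of $G_n(x)$ is $O(n)$.
   Context: An arithmetic circuit is a directed acyclic network whose gates each perform one binary arithmetic operation (addition, subtraction, multiplication or division); its inputs are the variables and scalars, and it outputs a rational function in the variables. The size of a circuit is its number of gates. The ordinary arithmetic circuit complexity of a rational function is the smallest size of an arithmetic circuit computing it (with the allowed input constants as specified). The subtraction-free complexity of a rational function is the smallest size of a circuit computing it that uses only addition, multiplication and division gates, with the variables and arbitrary positive integer scalars as inputs; it is finite exactly when such a circuit exists. -}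

module Defs where

open import Data.Nat as ℕ using (ℕ; zero; suc)
import Data.Nat.Properties as ℕP
open import Data.Integer using (+_)
open import Data.Rational using (ℚ; 0ℚ; 1ℚ; _+_; _*_; _/_; ≢-nonZero) renaming (-_ to -ℚ_; 1/_ to inv)
open import Data.Rational.Properties
  using (+-identityˡ; +-identityʳ; *-zeroˡ; *-zeroʳ; *-identityˡ; *-assoc; *-inverseˡ; _≟_)
open import Data.Fin using (Fin; zero; suc)
open import Data.List using (List; []; _∷_; map)
open import Data.Product using (Σ; ∃; _×_; _,_)
open import Data.Unit using (⊤)
open import Relation.Nullary using (¬_; yes; no)
open import Relation.Binary.PropositionalEquality
  using (_≡_; _≢_; refl; sym; trans; cong; cong₂; module ≡-Reasoning)

------------------------------------------------------------------------
-- The polynomial ring ℚ[x]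

-- Coefficient lists, constant term first.  Trailing zeros are permitted,
-- so polynomials are compared with _≋_ and not with _≡_.
Poly : Set
Poly = List ℚ

coeff : Poly → ℕ → ℚ
coeff []      _       = 0ℚ
coeff (a ∷ p) zero    = a
coeff (a ∷ p) (suc i) = coeff p i

infix 4 _≋_
_≋_ : Poly → Poly → Set
p ≋ q = ∀ i → coeff p i ≡ coeff q i

infixl 6 _+ₚ_ _-ₚ_
infixl 7 _*ₚ_ _·ₚ_
infix  8 -ₚ_

_+ₚ_ : Poly → Poly → Poly
[]      +ₚ q       = q
(a ∷ p) +ₚ []      = a ∷ p
(a ∷ p) +ₚ (b ∷ q) = (a + b) ∷ (p +ₚ q)

-ₚ_ : Poly → Poly
-ₚ_ = map -ℚ_

_-ₚ_ : Poly → Poly → Poly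
p -ₚ q = p +ₚ (-ₚ q)

_·ₚ_ : ℚ → Poly → Poly
a ·ₚ p = map (a *_) p

_*ₚ_ : Poly → Poly → Poly
[]      *ₚ q = []
(a ∷ p) *ₚ q = (a ·ₚ q) +ₚ (0ℚ ∷ (p *ₚ q))

constₚ : ℚ → Poly
constₚ c = c ∷ []

Xₚ : Poly
Xₚ = 0ℚ ∷ 1ℚ ∷ []

------------------------------------------------------------------------
-- ℚ[x] is an integral domain

coeff-+ₚ : ∀ p q i → coeff (p +ₚ q) i ≡ coeff p i + coeff q i
coeff-+ₚ []      q       i       = sym (+-identityˡ (coeff q i))
coeff-+ₚ (a ∷ p) []      i       = sym (+-identityʳ (coeff (a ∷ p) i))
coeff-+ₚ (a ∷ p) (b ∷ q) zero    = refl
coeff-+ₚ (a ∷ p) (b ∷ q) (suc i) = coeff-+ₚ p q i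

coeff-·ₚ : ∀ a p i → coeff (a ·ₚ p) i ≡ a * coeff p i
coeff-·ₚ a []      i       = sym (*-zeroʳ a)
coeff-·ₚ a (b ∷ p) zero    = refl
coeff-·ₚ a (b ∷ p) (suc i) = coeff-·ₚ a p i

coeff-*ₚ : ∀ a p q i →
           coeff ((a ∷ p) *ₚ q) i ≡ a * coeff q i + coeff (0ℚ ∷ (p *ₚ q)) i
coeff-*ₚ a p q i =
  trans (coeff-+ₚ (a ·ₚ q) (0ℚ ∷ (p *ₚ q)) i)
        (cong (_+ coeff (0ℚ ∷ (p *ₚ q)) i) (coeff-·ₚ a q i))

*ₚ-shiftʳ : ∀ p q → p *ₚ (0ℚ ∷ q) ≋ 0ℚ ∷ (p *ₚ q)
*ₚ-shiftʳ []      q zero    = refl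
*ₚ-shiftʳ []      q (suc i) = refl
*ₚ-shiftʳ (a ∷ p) q zero    = trans (+-identityʳ (a * 0ℚ)) (*-zeroʳ a)
*ₚ-shiftʳ (a ∷ p) q (suc i) =
  trans (coeff-*ₚ a p (0ℚ ∷ q) (suc i))
        (trans (cong (_+_ (a * coeff q i)) (*ₚ-shiftʳ p q i))
               (sym (coeff-*ₚ a p q i)))

*ₚ-zeroˡ : ∀ p q → p ≋ [] → p *ₚ q ≋ []
*ₚ-zeroˡ []      q z i = refl
*ₚ-zeroˡ (a ∷ p) q z i =
  trans (coeff-*ₚ a p q i)
        (trans (cong₂ _+_ (trans (cong (_* coeff q i) (z zero)) (*-zeroˡ (coeff q i)))
                          (tail i))
               (+-identityˡ 0ℚ))
  where
  tail : ∀ i → coeff (0ℚ ∷ (p *ₚ q)) i ≡ 0ℚ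
  tail zero    = refl
  tail (suc i) = *ₚ-zeroˡ p q (λ j → z (suc j)) i

*-cancel-0 : ∀ a b → a ≢ 0ℚ → a * b ≡ 0ℚ → b ≡ 0ℚ
*-cancel-0 a b a≢0 ab≡0 = begin
  b                ≡⟨ *-identityˡ b ⟨
  1ℚ * b           ≡⟨ cong (_* b) (*-inverseˡ a) ⟨
  (inv a * a) * b  ≡⟨ *-assoc (inv a) a b ⟩
  inv a * (a * b)  ≡⟨ cong (inv a *_) ab≡0 ⟩
  inv a * 0ℚ       ≡⟨ *-zeroʳ (inv a) ⟩
  0ℚ               ∎
  where
  open ≡-Reasoning
  instance a-nonZero = ≢-nonZero a≢0

*ₚ-cancel-0 : ∀ a p q → a ≢ 0ℚ → (a ∷ p) *ₚ q ≋ [] → q ≋ []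
*ₚ-cancel-0 a p []      a≢0 z i = refl
*ₚ-cancel-0 a p (b ∷ q) a≢0 z
  with *-cancel-0 a b a≢0 (trans (sym (+-identityʳ (a * b))) (z zero))
... | refl = λ where
  zero    → refl
  (suc i) → *ₚ-cancel-0 a p q a≢0
              (λ j → trans (sym (*ₚ-shiftʳ (a ∷ p) q (suc j))) (z (suc j))) i

*ₚ-nonZero : ∀ p q → ¬ (p ≋ []) → ¬ (q ≋ []) → ¬ (p *ₚ q ≋ [])
*ₚ-nonZero []      q p≉0 q≉0 z = p≉0 (λ i → refl)
*ₚ-nonZero (a ∷ p) q p≉0 q≉0 z with a ≟ 0ℚ
... | no  a≢0  = q≉0 (*ₚ-cancel-0 a p q a≢0 z)
... | yes refl = *ₚ-nonZero p q p≉0′ q≉0 pq≋0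
  where
  p≉0′ : ¬ (p ≋ [])
  p≉0′ w = p≉0 λ where
    zero    → refl
    (suc i) → w i
  pq≋0 : p *ₚ q ≋ []
  pq≋0 i = begin
    coeff (p *ₚ q) i                           ≡⟨ +-identityˡ _ ⟨
    0ℚ + coeff (p *ₚ q) i                      ≡⟨ cong (_+ coeff (p *ₚ q) i) (*-zeroˡ (coeff q (suc i))) ⟨
    0ℚ * coeff q (suc i) + coeff (p *ₚ q) i    ≡⟨ coeff-*ₚ 0ℚ p q (suc i) ⟨
    coeff ((0ℚ ∷ p) *ₚ q) (suc i)              ≡⟨ z (suc i) ⟩
    0ℚ                                         ∎
    where open ≡-Reasoning

1ₚ≉0 : ¬ (constₚ 1ℚ ≋ [])
1ₚ≉0 z with z zero
... | ()

------------------------------------------------------------------------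
-- The field of rational functions ℚ(x)

-- Formal fractions, not reduced to lowest terms; equality is _≃_.
record RatFun : Set where
  constructor _÷_[_]
  field
    num   : Poly
    den   : Poly
    den≉0 : ¬ (den ≋ [])

open RatFun public

infix 4 _≃_
_≃_ : RatFun → RatFun → Set
u ≃ v = num u *ₚ den v ≋ num v *ₚ den u

ι : Poly → RatFun
ι p = p ÷ constₚ 1ℚ [ 1ₚ≉0 ]

0ᵣ : RatFun
0ᵣ = ι []

infixl 6 _+ᵣ_ _-ᵣ_
infixl 7 _*ᵣ_

_+ᵣ_ : RatFun → RatFun → RatFun
u +ᵣ v = (num u *ₚ den v +ₚ num v *ₚ den u) ÷ den u *ₚ den v
           [ *ₚ-nonZero (den u) (den v) (den≉0 u) (den≉0 v) ]

_-ᵣ_ : RatFun → RatFun → RatFun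
u -ᵣ v = (num u *ₚ den v -ₚ num v *ₚ den u) ÷ den u *ₚ den v
           [ *ₚ-nonZero (den u) (den v) (den≉0 u) (den≉0 v) ]

_*ᵣ_ : RatFun → RatFun → RatFun
u *ᵣ v = (num u *ₚ num v) ÷ den u *ₚ den v
           [ *ₚ-nonZero (den u) (den v) (den≉0 u) (den≉0 v) ]

num≉0 : ∀ v → ¬ (v ≃ 0ᵣ) → ¬ (num v ≋ [])
num≉0 v v≄0 z = v≄0 (*ₚ-zeroˡ (num v) (constₚ 1ℚ) z)

divᵣ : (u v : RatFun) → ¬ (v ≃ 0ᵣ) → RatFun
divᵣ u v v≄0 = (num u *ₚ den v) ÷ den u *ₚ num v
                 [ *ₚ-nonZero (den u) (num v) (den≉0 u) (num≉0 v v≄0) ]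

------------------------------------------------------------------------
-- Arithmetic circuits in one variable

data Op : Set where
  add sub mul div : Op

-- A gate may only divide by a rational function that is not identically zero.
Defined : Op → RatFun → Set
Defined div v = ¬ (v ≃ 0ᵣ)
Defined _   v = ⊤

apply : (o : Op) (u v : RatFun) → Defined o v → RatFun
apply add u v _   = u +ᵣ v
apply sub u v _   = u -ᵣ v
apply mul u v _   = u *ᵣ v
apply div u v v≄0 = divᵣ u v v≄0

-- The operations and the input constants that a class of circuits may use.
record Basis : Set₁ where
  field
    Gate  : Op → Set
    Const : ℚ → Set

open Basis public

-- The possible sources of a wire in a network with k gates.
data Node (B : Basis) (k : ℕ) : Set where
  var   : Node B k
  const : (c : ℚ) → Const B c → Node B k
  gate  : Fin k → Node B k

-- A network with k gates, listed in a topological order: each new gate takes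
-- its two arguments from the inputs and the earlier gates, and any node may be
-- reused (unbounded fan-out).  Gates are indexed from the most recent one, so
-- `gate zero` is the gate added last.  Inputs do not count as gates.
mutual
  data Network (B : Basis) : ℕ → Set where
    ∅   : Network B zero
    ext : ∀ {k} (N : Network B k) (o : Op) → Gate B o →
          (a b : Node B k) → Defined o (value N b) → Network B (suc k)

  value : ∀ {B k} → Network B k → Node B k → RatFun
  value N                 var            = ι Xₚ
  value N                 (const c _)    = ι (constₚ c)
  value (ext N o _ a b d) (gate zero)    = apply o (value N a) (value N b) d
  value (ext N o _ a b d) (gate (suc i)) = value N (gate i)

record Circuit (B : Basis) : Set where
  field
    size    : ℕ
    network : Network B size
    output  : Node B size

open Circuit public

⟦_⟧ : ∀ {B} → Circuit B → RatFun
⟦ C ⟧ = value (network C) (output C)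

infix 4 _Computes_
_Computes_ : ∀ {B} → Circuit B → RatFun → Set
C Computes f = ⟦ C ⟧ ≃ f

------------------------------------------------------------------------
-- Complexity

-- The complexity of f over B is the minimum of the sizes of the circuits
-- computing f (infinite if there are none).  This minimum is not available as
-- a constructive function of f, so it is represented by the
-- assertions that are made about it: min S < ∞ says that S is inhabited,
-- min S ≤ m that some element of S is ≤ m, and min S > m that all are > m.

FiniteComplexity : Basis → RatFun → Set
FiniteComplexity B f = Σ (Circuit B) λ C → C Computes f

Complexity≤ : Basis → RatFun → ℕ → Set
Complexity≤ B f m = Σ (Circuit B) λ C → C Computes f × size C ℕ.≤ m

Complexity> : Basis → RatFun → ℕ → Set
Complexity> B f m = (C : Circuit B) → C Computes f → size C ℕ.> m

data SubtractionFreeOp : Op → Set where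
  add : SubtractionFreeOp add
  mul : SubtractionFreeOp mul
  div : SubtractionFreeOp div

subtractionFree : Basis
subtractionFree = record
  { Gate  = SubtractionFreeOp
  ; Const = λ c → ∃ λ m → c ≡ + suc m / 1
  }

ordinary : Basis
ordinary = record { Gate = λ _ → ⊤ ; Const = λ _ → ⊤ }

ordinaryFrom1 : Basis
ordinaryFrom1 = record { Gate = λ _ → ⊤ ; Const = λ c → c ≡ 1ℚ }

------------------------------------------------------------------------
-- The polynomials (x - 1)² + 2^(-2^(n+1))

ε : ℕ → ℚ
ε n = (+ 1 / (2 ℕ.^ (2 ℕ.^ (n ℕ.+ 1)))) {{ℕP.m^n≢0 2 (2 ℕ.^ (n ℕ.+ 1))}}

G : ℕ → Poly
G n = (Xₚ -ₚ constₚ 1ℚ) *ₚ (Xₚ -ₚ constₚ 1ℚ) +ₚ constₚ (ε n)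

{-# OPTIONS --safe #-}

-- Lower bound: a subtraction-free circuit with s gates yields a fraction p / q
-- whose numerator and denominator have nonnegative coefficients and degree at
-- most 2^s, and p = G_n q.  The roots of G_n are 1 ± i / N with N = 2^(2^n); that
-- they are too close to the positive axis for p to have degree ≤ N is certified
-- by the linear functional x^k ↦ 2N² - k², which is positive on x^k for k ≤ N
-- but nonpositive on x^k G_n for all k.
--
-- Finiteness: multiplying a y² - b y + c by a y² + b y + c gives a quadratic in
-- y² (Graeffe's root squaring); each step doubles the argument of the roots, so
-- eventually the middle coefficient becomes nonnegative.

module Submission where

open import Defs
open import Algebra.Bundles using (CommutativeRing)
open import Data.Fin using (zero; suc)
open import Data.Integer as ℤ using (+_)
import Data.Integer.Tactic.RingSolver as ℤ-Solver
open import Data.List using ([]; _∷_; length)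
open import Data.List.Properties using (length-map)
open import Data.List.Relation.Unary.All using (All; []; _∷_)
open import Data.Maybe using (just; nothing)
open import Data.Nat
  using (ℕ; zero; suc; pred; _+_; _*_; _^_; _∸_; _≤_; _<_; z≤n; s≤s; z<s; s<s; NonZero)
import Data.Nat.Properties as ℕP
import Data.Nat.Tactic.RingSolver as ℕ-Solver
open import Data.Product using (_×_; _,_; ∃-syntax)
open import Data.Rational as ℚ using (ℚ; 0ℚ; 1ℚ; _/_; nonNegative; positive)
  renaming (_+_ to _+ℚ_; _*_ to _*ℚ_; -_ to -ℚ_; _≤_ to _≤ℚ_; _<_ to _<ℚ_)
import Data.Rational.Properties as ℚP
open import Algebra.Properties.Semiring.Mult (CommutativeRing.semiring ℚP.+-*-commutativeRing)
  using (×-homo-+; ×1-homo-*) renaming (_×_ to _×ℚ_)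
import Data.Rational.Unnormalised as ℚᵘ
import Data.Rational.Unnormalised.Properties as ℚᵘP
open import Data.Unit using (tt)
open import Function using (_∘_)
open import Level using (0ℓ)
open import Relation.Binary.PropositionalEquality
  using (_≡_; refl; sym; trans; cong; cong₂; subst; subst₂; module ≡-Reasoning)
open import Relation.Nullary using (¬_; contradiction; yes; no)
open import Relation.Nullary.Decidable using (dec⇒maybe)
open import Tactic.RingSolver using (solve-∀)
import Tactic.RingSolver.Core.AlmostCommutativeRing as ACR

-- The commutative ring ℚ[x]

ℚ-ring : ACR.AlmostCommutativeRing 0ℓ 0ℓ
ℚ-ring = ACR.fromCommutativeRing ℚP.+-*-commutativeRing λ q → dec⇒maybe (0ℚ ℚP.≟ q)

-- _≋_ wrapped in a record, so that Agda can infer the two polynomials.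
infix 4 _≈_
record _≈_ (p q : Poly) : Set where
  constructor equal
  field
    at : p ≋ q
open _≈_

≈-refl : ∀ {p} → p ≈ p
≈-refl .at i = refl

≈-sym : ∀ {p q} → p ≈ q → q ≈ p
≈-sym e .at i = sym (e .at i)

≈-trans : ∀ {p q r} → p ≈ q → q ≈ r → p ≈ r
≈-trans e f .at i = trans (e .at i) (f .at i)

infixr 5 _∷-cong_
_∷-cong_ : ∀ {a b p q} → a ≡ b → p ≈ q → a ∷ p ≈ b ∷ q
(e ∷-cong f) .at zero    = e
(e ∷-cong f) .at (suc i) = f .at i

+ₚ-cong : ∀ {p p′ q q′} → p ≈ p′ → q ≈ q′ → p +ₚ q ≈ p′ +ₚ q′
+ₚ-cong {p} {p′} {q} {q′} e f .at i =
  trans (coeff-+ₚ p q i) (trans (cong₂ _+ℚ_ (e .at i) (f .at i)) (sym (coeff-+ₚ p′ q′ i)))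

+ₚ-assoc : ∀ p q r → (p +ₚ q) +ₚ r ≈ p +ₚ (q +ₚ r)
+ₚ-assoc p q r .at i = begin
  coeff ((p +ₚ q) +ₚ r) i                  ≡⟨ coeff-+ₚ (p +ₚ q) r i ⟩
  coeff (p +ₚ q) i +ℚ coeff r i            ≡⟨ cong (_+ℚ coeff r i) (coeff-+ₚ p q i) ⟩
  coeff p i +ℚ coeff q i +ℚ coeff r i      ≡⟨ ℚP.+-assoc (coeff p i) (coeff q i) (coeff r i) ⟩
  coeff p i +ℚ (coeff q i +ℚ coeff r i)    ≡⟨ cong (coeff p i +ℚ_) (coeff-+ₚ q r i) ⟨
  coeff p i +ℚ coeff (q +ₚ r) i            ≡⟨ coeff-+ₚ p (q +ₚ r) i ⟨
  coeff (p +ₚ (q +ₚ r)) i                  ∎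
  where open ≡-Reasoning

+ₚ-comm : ∀ p q → p +ₚ q ≈ q +ₚ p
+ₚ-comm p q .at i =
  trans (coeff-+ₚ p q i) (trans (ℚP.+-comm (coeff p i) (coeff q i)) (sym (coeff-+ₚ q p i)))

+ₚ-identityʳ : ∀ p → p +ₚ [] ≈ p
+ₚ-identityʳ p = +ₚ-comm p []

coeff--ₚ : ∀ p i → coeff (-ₚ p) i ≡ -ℚ coeff p i
coeff--ₚ []      i       = refl
coeff--ₚ (a ∷ p) zero    = refl
coeff--ₚ (a ∷ p) (suc i) = coeff--ₚ p i

-ₚ-cong : ∀ p q → p ≈ q → -ₚ p ≈ -ₚ q
-ₚ-cong p q e .at i = trans (coeff--ₚ p i) (trans (cong -ℚ_ (e .at i)) (sym (coeff--ₚ q i)))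

-ₚ-inverseˡ : ∀ p → (-ₚ p) +ₚ p ≈ []
-ₚ-inverseˡ p .at i =
  trans (coeff-+ₚ (-ₚ p) p i)
        (trans (cong (_+ℚ coeff p i) (coeff--ₚ p i)) (ℚP.+-inverseˡ (coeff p i)))

·ₚ-cong : ∀ a {p q} → p ≈ q → a ·ₚ p ≈ a ·ₚ q
·ₚ-cong a {p} {q} e .at i =
  trans (coeff-·ₚ a p i) (trans (cong (a *ℚ_) (e .at i)) (sym (coeff-·ₚ a q i)))

0·ₚ : ∀ p → 0ℚ ·ₚ p ≈ []
0·ₚ p .at i = trans (coeff-·ₚ 0ℚ p i) (ℚP.*-zeroˡ (coeff p i))

shift-+ₚ : ∀ p q → 0ℚ ∷ (p +ₚ q) ≈ (0ℚ ∷ p) +ₚ (0ℚ ∷ q)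
shift-+ₚ p q .at zero    = refl
shift-+ₚ p q .at (suc i) = refl

·ₚ-distribˡ-+ₚ : ∀ a p q → a ·ₚ (p +ₚ q) ≈ a ·ₚ p +ₚ a ·ₚ q
·ₚ-distribˡ-+ₚ a p q .at i = begin
  coeff (a ·ₚ (p +ₚ q)) i               ≡⟨ coeff-·ₚ a (p +ₚ q) i ⟩
  a *ℚ coeff (p +ₚ q) i                 ≡⟨ cong (a *ℚ_) (coeff-+ₚ p q i) ⟩
  a *ℚ (coeff p i +ℚ coeff q i)          ≡⟨ ℚP.*-distribˡ-+ a (coeff p i) (coeff q i) ⟩
  a *ℚ coeff p i +ℚ a *ℚ coeff q i       ≡⟨ cong₂ _+ℚ_ (coeff-·ₚ a p i) (coeff-·ₚ a q i) ⟨
  coeff (a ·ₚ p) i +ℚ coeff (a ·ₚ q) i   ≡⟨ coeff-+ₚ (a ·ₚ p) (a ·ₚ q) i ⟨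
  coeff (a ·ₚ p +ₚ a ·ₚ q) i            ∎
  where open ≡-Reasoning

·ₚ-distribʳ-+ₚ : ∀ a b p → (a +ℚ b) ·ₚ p ≈ a ·ₚ p +ₚ b ·ₚ p
·ₚ-distribʳ-+ₚ a b p .at i = begin
  coeff ((a +ℚ b) ·ₚ p) i                ≡⟨ coeff-·ₚ (a +ℚ b) p i ⟩
  (a +ℚ b) *ℚ coeff p i                  ≡⟨ ℚP.*-distribʳ-+ (coeff p i) a b ⟩
  a *ℚ coeff p i +ℚ b *ℚ coeff p i       ≡⟨ cong₂ _+ℚ_ (coeff-·ₚ a p i) (coeff-·ₚ b p i) ⟨
  coeff (a ·ₚ p) i +ℚ coeff (b ·ₚ p) i   ≡⟨ coeff-+ₚ (a ·ₚ p) (b ·ₚ p) i ⟨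
  coeff (a ·ₚ p +ₚ b ·ₚ p) i            ∎
  where open ≡-Reasoning

·ₚ-·ₚ : ∀ a b p → a ·ₚ (b ·ₚ p) ≈ (a *ℚ b) ·ₚ p
·ₚ-·ₚ a b p .at i = begin
  coeff (a ·ₚ (b ·ₚ p)) i    ≡⟨ coeff-·ₚ a (b ·ₚ p) i ⟩
  a *ℚ coeff (b ·ₚ p) i      ≡⟨ cong (a *ℚ_) (coeff-·ₚ b p i) ⟩
  a *ℚ (b *ℚ coeff p i)      ≡⟨ ℚP.*-assoc a b (coeff p i) ⟨
  a *ℚ b *ℚ coeff p i        ≡⟨ coeff-·ₚ (a *ℚ b) p i ⟨
  coeff ((a *ℚ b) ·ₚ p) i    ∎
  where open ≡-Reasoning

+ₚ-interchange : ∀ p q r s → (p +ₚ q) +ₚ (r +ₚ s) ≈ (p +ₚ r) +ₚ (q +ₚ s)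
+ₚ-interchange p q r s .at i = begin
  coeff ((p +ₚ q) +ₚ (r +ₚ s)) i                              ≡⟨ expand p q r s ⟩
  (coeff p i +ℚ coeff q i) +ℚ (coeff r i +ℚ coeff s i)           ≡⟨ swap (coeff p i) _ _ _ ⟩
  (coeff p i +ℚ coeff r i) +ℚ (coeff q i +ℚ coeff s i)           ≡⟨ expand p r q s ⟨
  coeff ((p +ₚ r) +ₚ (q +ₚ s)) i                              ∎
  where
  open ≡-Reasoning
  expand : ∀ p q r s → coeff ((p +ₚ q) +ₚ (r +ₚ s)) i ≡
                       (coeff p i +ℚ coeff q i) +ℚ (coeff r i +ℚ coeff s i)
  expand p q r s = trans (coeff-+ₚ (p +ₚ q) (r +ₚ s) i) (cong₂ _+ℚ_ (coeff-+ₚ p q i) (coeff-+ₚ r s i))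
  swap : ∀ a b c d → (a +ℚ b) +ℚ (c +ℚ d) ≡ (a +ℚ c) +ℚ (b +ℚ d)
  swap = solve-∀ ℚ-ring

0∷[]≈[] : 0ℚ ∷ [] ≈ []
0∷[]≈[] .at zero    = refl
0∷[]≈[] .at (suc i) = refl

*ₚ-congʳ : ∀ p q r → q ≈ r → p *ₚ q ≈ p *ₚ r
*ₚ-congʳ []      q r e = ≈-refl
*ₚ-congʳ (a ∷ p) q r e =
  +ₚ-cong (·ₚ-cong a e) (refl ∷-cong *ₚ-congʳ p q r e)

*ₚ-zeroʳ : ∀ p → p *ₚ [] ≈ []
*ₚ-zeroʳ []      = ≈-refl
*ₚ-zeroʳ (a ∷ p) = ≈-trans (refl ∷-cong *ₚ-zeroʳ p) 0∷[]≈[]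

-- `_*ₚ_` recurses on its left factor; this is the mirrored recursion on the right factor, which
-- makes commutativity a plain induction.
*ₚ-∷ʳ : ∀ p b q → p *ₚ (b ∷ q) ≈ b ·ₚ p +ₚ (0ℚ ∷ (p *ₚ q))
*ₚ-∷ʳ []      b q = ≈-sym 0∷[]≈[]
*ₚ-∷ʳ (a ∷ p) b q = cong (_+ℚ 0ℚ) (ℚP.*-comm a b) ∷-cong
  ≈-trans (+ₚ-cong ≈-refl (*ₚ-∷ʳ p b q))
 (≈-trans (≈-sym (+ₚ-assoc (a ·ₚ q) (b ·ₚ p) (0ℚ ∷ (p *ₚ q))))
 (≈-trans (+ₚ-cong (+ₚ-comm (a ·ₚ q) (b ·ₚ p)) ≈-refl)
          (+ₚ-assoc (b ·ₚ p) (a ·ₚ q) (0ℚ ∷ (p *ₚ q)))))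

*ₚ-comm : ∀ p q → p *ₚ q ≈ q *ₚ p
*ₚ-comm []      q = ≈-sym (*ₚ-zeroʳ q)
*ₚ-comm (a ∷ p) q =
  ≈-trans (+ₚ-cong ≈-refl (refl ∷-cong *ₚ-comm p q))
          (≈-sym (*ₚ-∷ʳ q a p))

-- Equal polynomials may be lists of different lengths, so induction on the left factor would need
-- extra cases; commutativity reduces it to `*ₚ-congʳ`.
*ₚ-cong : ∀ {p p′ q q′} → p ≈ p′ → q ≈ q′ → p *ₚ q ≈ p′ *ₚ q′
*ₚ-cong {p} {p′} {q} {q′} e f =
  ≈-trans (*ₚ-congʳ p q q′ f)
 (≈-trans (*ₚ-comm p q′) (≈-trans (*ₚ-congʳ q′ p p′ e) (*ₚ-comm q′ p′)))

*ₚ-distribʳ : ∀ r p q → (p +ₚ q) *ₚ r ≈ p *ₚ r +ₚ q *ₚ r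
*ₚ-distribʳ r []      q       = ≈-refl
*ₚ-distribʳ r (a ∷ p) []      = ≈-sym (+ₚ-identityʳ ((a ∷ p) *ₚ r))
*ₚ-distribʳ r (a ∷ p) (b ∷ q) =
  ≈-trans (+ₚ-cong (·ₚ-distribʳ-+ₚ a b r)
                   (≈-trans (refl ∷-cong *ₚ-distribʳ r p q) (shift-+ₚ (p *ₚ r) (q *ₚ r))))
          (+ₚ-interchange (a ·ₚ r) (b ·ₚ r) (0ℚ ∷ (p *ₚ r)) (0ℚ ∷ (q *ₚ r)))

·ₚ-*ₚ : ∀ a p q → (a ·ₚ p) *ₚ q ≈ a ·ₚ (p *ₚ q)
·ₚ-*ₚ a []      q = ≈-refl
·ₚ-*ₚ a (b ∷ p) q =
  ≈-trans (+ₚ-cong (≈-sym (·ₚ-·ₚ a b q))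
                   (sym (ℚP.*-zeroʳ a) ∷-cong ·ₚ-*ₚ a p q))
          (≈-sym (·ₚ-distribˡ-+ₚ a (b ·ₚ q) (0ℚ ∷ (p *ₚ q))))

shift-*ₚ : ∀ p q → (0ℚ ∷ p) *ₚ q ≈ 0ℚ ∷ (p *ₚ q)
shift-*ₚ p q = +ₚ-cong (0·ₚ q) ≈-refl

*ₚ-assoc : ∀ p q r → (p *ₚ q) *ₚ r ≈ p *ₚ (q *ₚ r)
*ₚ-assoc []      q r = ≈-refl
*ₚ-assoc (a ∷ p) q r =
  ≈-trans (*ₚ-distribʳ r (a ·ₚ q) (0ℚ ∷ (p *ₚ q)))
          (+ₚ-cong (·ₚ-*ₚ a q r)
                   (≈-trans (shift-*ₚ (p *ₚ q) r) (refl ∷-cong *ₚ-assoc p q r)))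

1ₚ : Poly
1ₚ = constₚ 1ℚ

*ₚ-identityˡ : ∀ p → 1ₚ *ₚ p ≈ p
*ₚ-identityˡ p .at i = trans (coeff-*ₚ 1ℚ [] p i)
  (trans (cong₂ _+ℚ_ (ℚP.*-identityˡ (coeff p i)) (0∷[]≈[] .at i)) (ℚP.+-identityʳ (coeff p i)))

polyRing : CommutativeRing 0ℓ 0ℓ
polyRing = record
  { Carrier = Poly
  ; _≈_     = _≈_
  ; _+_     = _+ₚ_
  ; _*_     = _*ₚ_
  ; -_      = -ₚ_
  ; 0#      = []
  ; 1#      = 1ₚ
  ; isCommutativeRing = record
    { isRing = record
      { +-isAbelianGroup = record
        { isGroup = record
          { isMonoid = record
            { isSemigroup = record
              { isMagma = record
                { isEquivalence = record { refl = ≈-refl ; sym = ≈-sym ; trans = ≈-trans }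
                ; ∙-cong        = +ₚ-cong
                }
              ; assoc = +ₚ-assoc
              }
            ; identity = (λ p → ≈-refl) , +ₚ-identityʳ
            }
          ; inverse = -ₚ-inverseˡ , λ p → ≈-trans (+ₚ-comm p (-ₚ p)) (-ₚ-inverseˡ p)
          ; ⁻¹-cong = λ {p} {q} → -ₚ-cong p q
          }
        ; comm = +ₚ-comm
        }
      ; *-cong     = *ₚ-cong
      ; *-assoc    = *ₚ-assoc
      ; *-identity = *ₚ-identityˡ , λ p → ≈-trans (*ₚ-comm p 1ₚ) (*ₚ-identityˡ p)
      ; distrib    = (λ r p q → ≈-trans (*ₚ-comm r (p +ₚ q))
                                (≈-trans (*ₚ-distribʳ r p q)
                                         (+ₚ-cong (*ₚ-comm p r) (*ₚ-comm q r))))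
                   , *ₚ-distribʳ
      }
    ; *-comm = *ₚ-comm
    }
  }

poly-ring : ACR.AlmostCommutativeRing 0ℓ 0ℓ
poly-ring = ACR.fromCommutativeRing polyRing λ where
  []      → just ≈-refl
  (_ ∷ _) → nothing

-- Natural numbers in ℚ

-- As an iterated sum of `1ℚ`, `fromℕ (suc n)` reduces to `1ℚ +ℚ fromℕ n`, which the ring identities
-- below exploit.
fromℕ : ℕ → ℚ
fromℕ n = n ×ℚ 1ℚ

fromℕ-+ : ∀ m n → fromℕ (m + n) ≡ fromℕ m +ℚ fromℕ n
fromℕ-+ = ×-homo-+ 1ℚ

fromℕ-* : ∀ m n → fromℕ (m * n) ≡ fromℕ m *ℚ fromℕ n
fromℕ-* = ×1-homo-*

0≤fromℕ : ∀ n → 0ℚ ≤ℚ fromℕ n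
0≤fromℕ zero    = ℚP.≤-refl
0≤fromℕ (suc n) = ℚP.+-mono-≤ (ℚP.nonNegative⁻¹ 1ℚ) (0≤fromℕ n)

fromℕ-mono-< : ∀ {m n} → m < n → fromℕ m <ℚ fromℕ n
fromℕ-mono-< {zero}  {suc n} _         = ℚP.+-mono-<-≤ (ℚP.positive⁻¹ 1ℚ) (0≤fromℕ n)
fromℕ-mono-< {suc m} {suc n} (s<s m<n) = ℚP.+-monoʳ-< 1ℚ (fromℕ-mono-< m<n)

-- Links the input constants of the basis, written as fractions, to `fromℕ`. Passing to unnormalised
-- rationals avoids the gcds hidden in `_/_`.
/1≡fromℕ : ∀ n → + n / 1 ≡ fromℕ n
/1≡fromℕ zero    = refl
/1≡fromℕ (suc n) = ℚP.toℚᵘ-injective (begin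
  ℚ.toℚᵘ (+ suc n / 1)                              ≈⟨ ℚP.toℚᵘ-fromℚᵘ _ ⟩
  ℚᵘ.mkℚᵘ (+ suc n) 0                               ≈⟨ ℚᵘ.*≡* (lemma (+ n)) ⟩
  ℚᵘ.1ℚᵘ ℚᵘ.+ ℚᵘ.mkℚᵘ (+ n) 0                       ≈⟨ ℚᵘP.+-congʳ ℚᵘ.1ℚᵘ (ℚP.toℚᵘ-fromℚᵘ (ℚᵘ.mkℚᵘ (+ n) 0)) ⟨
  ℚᵘ.1ℚᵘ ℚᵘ.+ ℚ.toℚᵘ (+ n / 1)                      ≈⟨ ℚP.toℚᵘ-homo-+ 1ℚ (+ n / 1) ⟨
  ℚ.toℚᵘ (1ℚ +ℚ + n / 1)                            ≡⟨ cong (λ q → ℚ.toℚᵘ (1ℚ +ℚ q)) (/1≡fromℕ n) ⟩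
  ℚ.toℚᵘ (fromℕ (suc n))                            ∎)
  where
  open import Relation.Binary.Reasoning.Setoid ℚᵘP.≃-setoid
  lemma : ∀ k → (ℤ.1ℤ ℤ.+ k) ℤ.* ℤ.1ℤ ≡ (ℤ.1ℤ ℤ.* ℤ.1ℤ ℤ.+ k ℤ.* ℤ.1ℤ) ℤ.* ℤ.1ℤ
  lemma = ℤ-Solver.solve-∀

1/n*n≡1 : ∀ n .{{_ : NonZero n}} → (+ 1 / n) *ℚ fromℕ n ≡ 1ℚ
1/n*n≡1 (suc n) = trans (cong ((+ 1 / suc n) *ℚ_) (sym (/1≡fromℕ (suc n)))) (ℚP.toℚᵘ-injective (begin
  ℚ.toℚᵘ ((+ 1 / suc n) *ℚ (+ suc n / 1))             ≈⟨ ℚP.toℚᵘ-homo-* (+ 1 / suc n) (+ suc n / 1) ⟩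
  ℚ.toℚᵘ (+ 1 / suc n) ℚᵘ.* ℚ.toℚᵘ (+ suc n / 1)      ≈⟨ ℚᵘP.*-cong (ℚP.toℚᵘ-fromℚᵘ (ℚᵘ.mkℚᵘ (+ 1) n))
                                                                     (ℚP.toℚᵘ-fromℚᵘ (ℚᵘ.mkℚᵘ (+ suc n) 0)) ⟩
  ℚᵘ.mkℚᵘ (+ 1) n ℚᵘ.* ℚᵘ.mkℚᵘ (+ suc n) 0            ≈⟨ ℚᵘ.*≡* (lemma (+ suc n)) ⟩
  ℚᵘ.1ℚᵘ ∎))
  where
  open import Relation.Binary.Reasoning.Setoid ℚᵘP.≃-setoid
  lemma : ∀ k → (ℤ.1ℤ ℤ.* k) ℤ.* ℤ.1ℤ ≡ ℤ.1ℤ ℤ.* (k ℤ.* ℤ.1ℤ)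
  lemma = ℤ-Solver.solve-∀

0≤*ℚ : ∀ {a b} → 0ℚ ≤ℚ a → 0ℚ ≤ℚ b → 0ℚ ≤ℚ a *ℚ b
0≤*ℚ {a} {b} 0≤a 0≤b = ℚP.nonNegative⁻¹ (a *ℚ b)
  {{ℚP.nonNeg*nonNeg⇒nonNeg a {{nonNegative 0≤a}} b {{nonNegative 0≤b}}}}

-- Linear functionals on ℚ[x]

-- The functional sending x^k to f k; multiplying p by x - 1 amounts to
-- replacing f by its difference sequence Δ f.
⟨_,_⟩ : Poly → (ℕ → ℚ) → ℚ
⟨ []    , f ⟩ = 0ℚ
⟨ a ∷ p , f ⟩ = a *ℚ f 0 +ℚ ⟨ p , f ∘ suc ⟩

⟨⟩-zero : ∀ p f → p ≋ [] → ⟨ p , f ⟩ ≡ 0ℚ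
⟨⟩-zero []      f e = refl
⟨⟩-zero (a ∷ p) f e = cong₂ _+ℚ_ (trans (cong (_*ℚ f 0) (e 0)) (ℚP.*-zeroˡ (f 0)))
                                 (⟨⟩-zero p (f ∘ suc) (e ∘ suc))

⟨⟩-congˡ : ∀ {p q} f → p ≈ q → ⟨ p , f ⟩ ≡ ⟨ q , f ⟩
⟨⟩-congˡ {[]}    {q}     f (equal e) = sym (⟨⟩-zero q f (sym ∘ e))
⟨⟩-congˡ {a ∷ p} {[]}    f (equal e) = ⟨⟩-zero (a ∷ p) f e
⟨⟩-congˡ {a ∷ p} {b ∷ q} f (equal e) =
  cong₂ _+ℚ_ (cong (_*ℚ f 0) (e 0)) (⟨⟩-congˡ {p} {q} (f ∘ suc) (equal (e ∘ suc)))

⟨⟩-+ : ∀ p q f → ⟨ p +ₚ q , f ⟩ ≡ ⟨ p , f ⟩ +ℚ ⟨ q , f ⟩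
⟨⟩-+ []      q       f = sym (ℚP.+-identityˡ _)
⟨⟩-+ (a ∷ p) []      f = sym (ℚP.+-identityʳ _)
⟨⟩-+ (a ∷ p) (b ∷ q) f =
  trans (cong ((a +ℚ b) *ℚ f 0 +ℚ_) (⟨⟩-+ p q (f ∘ suc)))
        (rearrange a b (f 0) ⟨ p , f ∘ suc ⟩ ⟨ q , f ∘ suc ⟩)
  where
  rearrange : ∀ a b x u v → (a +ℚ b) *ℚ x +ℚ (u +ℚ v) ≡ (a *ℚ x +ℚ u) +ℚ (b *ℚ x +ℚ v)
  rearrange = solve-∀ ℚ-ring

⟨⟩-· : ∀ a p f → ⟨ a ·ₚ p , f ⟩ ≡ a *ℚ ⟨ p , f ⟩
⟨⟩-· a []      f = sym (ℚP.*-zeroʳ a)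
⟨⟩-· a (b ∷ p) f =
  trans (cong (a *ℚ b *ℚ f 0 +ℚ_) (⟨⟩-· a p (f ∘ suc)))
        (rearrange a b (f 0) ⟨ p , f ∘ suc ⟩)
  where
  rearrange : ∀ a b x u → a *ℚ b *ℚ x +ℚ a *ℚ u ≡ a *ℚ (b *ℚ x +ℚ u)
  rearrange = solve-∀ ℚ-ring

⟨⟩-shift : ∀ p f → ⟨ 0ℚ ∷ p , f ⟩ ≡ ⟨ p , f ∘ suc ⟩
⟨⟩-shift p f = trans (cong (_+ℚ ⟨ p , f ∘ suc ⟩) (ℚP.*-zeroˡ (f 0))) (ℚP.+-identityˡ _)

⟨⟩-*-∷ : ∀ a p q f → ⟨ (a ∷ p) *ₚ q , f ⟩ ≡ a *ℚ ⟨ q , f ⟩ +ℚ ⟨ p *ₚ q , f ∘ suc ⟩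
⟨⟩-*-∷ a p q f = trans (⟨⟩-+ (a ·ₚ q) (0ℚ ∷ (p *ₚ q)) f)
                       (cong₂ _+ℚ_ (⟨⟩-· a q f) (⟨⟩-shift (p *ₚ q) f))

⟨⟩-linearʳ : ∀ a b p f g →
  a *ℚ ⟨ p , f ⟩ +ℚ b *ℚ ⟨ p , g ⟩ ≡ ⟨ p , (λ k → a *ℚ f k +ℚ b *ℚ g k) ⟩
⟨⟩-linearʳ a b []      f g = cong₂ _+ℚ_ (ℚP.*-zeroʳ a) (ℚP.*-zeroʳ b)
⟨⟩-linearʳ a b (c ∷ p) f g =
  trans (rearrange a b c (f 0) (g 0) ⟨ p , f ∘ suc ⟩ ⟨ p , g ∘ suc ⟩)
        (cong (c *ℚ (a *ℚ f 0 +ℚ b *ℚ g 0) +ℚ_) (⟨⟩-linearʳ a b p (f ∘ suc) (g ∘ suc)))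
  where
  rearrange : ∀ a b c x y u v →
    a *ℚ (c *ℚ x +ℚ u) +ℚ b *ℚ (c *ℚ y +ℚ v) ≡ c *ℚ (a *ℚ x +ℚ b *ℚ y) +ℚ (a *ℚ u +ℚ b *ℚ v)
  rearrange = solve-∀ ℚ-ring

-- The coefficients -1 and 1 are kept explicit so that this is literally a combination produced by
-- `⟨⟩-linearʳ`.
Δ : (ℕ → ℚ) → ℕ → ℚ
Δ f k = -ℚ 1ℚ *ℚ f k +ℚ 1ℚ *ℚ f (suc k)

⟨⟩-X-1 : ∀ q f → ⟨ (Xₚ -ₚ constₚ 1ℚ) *ₚ q , f ⟩ ≡ ⟨ q , Δ f ⟩
⟨⟩-X-1 q f = begin
  ⟨ (Xₚ -ₚ constₚ 1ℚ) *ₚ q , f ⟩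
    ≡⟨ ⟨⟩-*-∷ (-ℚ 1ℚ) (1ℚ ∷ []) q f ⟩
  -ℚ 1ℚ *ℚ ⟨ q , f ⟩ +ℚ ⟨ (1ℚ ∷ []) *ₚ q , f ∘ suc ⟩
    ≡⟨ cong (-ℚ 1ℚ *ℚ ⟨ q , f ⟩ +ℚ_) (trans (⟨⟩-*-∷ 1ℚ [] q (f ∘ suc)) (ℚP.+-identityʳ _)) ⟩
  -ℚ 1ℚ *ℚ ⟨ q , f ⟩ +ℚ 1ℚ *ℚ ⟨ q , f ∘ suc ⟩
    ≡⟨ ⟨⟩-linearʳ (-ℚ 1ℚ) 1ℚ q f (f ∘ suc) ⟩
  ⟨ q , Δ f ⟩ ∎
  where open ≡-Reasoning

-- Since G_n = (x - 1)² + ε, multiplication by `G n` becomes the operator Δ² + ε on sequences, by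
-- two uses of `⟨⟩-X-1`.
⟨⟩-G : ∀ n q f → ⟨ G n *ₚ q , f ⟩ ≡ ⟨ q , (λ k → 1ℚ *ℚ Δ (Δ f) k +ℚ ε n *ℚ f k) ⟩
⟨⟩-G n q f = begin
  ⟨ G n *ₚ q , f ⟩
    ≡⟨ ⟨⟩-congˡ f (expand (Xₚ -ₚ constₚ 1ℚ) (constₚ (ε n)) q) ⟩
  ⟨ (Xₚ -ₚ constₚ 1ℚ) *ₚ ((Xₚ -ₚ constₚ 1ℚ) *ₚ q) +ₚ constₚ (ε n) *ₚ q , f ⟩
    ≡⟨ ⟨⟩-+ ((Xₚ -ₚ constₚ 1ℚ) *ₚ ((Xₚ -ₚ constₚ 1ℚ) *ₚ q)) (constₚ (ε n) *ₚ q) f ⟩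
  ⟨ (Xₚ -ₚ constₚ 1ℚ) *ₚ ((Xₚ -ₚ constₚ 1ℚ) *ₚ q) , f ⟩ +ℚ ⟨ constₚ (ε n) *ₚ q , f ⟩
    ≡⟨ cong₂ _+ℚ_ (trans (⟨⟩-X-1 ((Xₚ -ₚ constₚ 1ℚ) *ₚ q) f)
                         (trans (⟨⟩-X-1 q (Δ f)) (sym (ℚP.*-identityˡ _))))
                  (trans (⟨⟩-*-∷ (ε n) [] q f) (ℚP.+-identityʳ _)) ⟩
  1ℚ *ℚ ⟨ q , Δ (Δ f) ⟩ +ℚ ε n *ℚ ⟨ q , f ⟩
    ≡⟨ ⟨⟩-linearʳ 1ℚ (ε n) q (Δ (Δ f)) f ⟩
  ⟨ q , (λ k → 1ℚ *ℚ Δ (Δ f) k +ℚ ε n *ℚ f k) ⟩ ∎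
  where
  open ≡-Reasoning
  expand : ∀ s e q → (s *ₚ s +ₚ e) *ₚ q ≈ s *ₚ (s *ₚ q) +ₚ e *ₚ q
  expand = solve-∀ poly-ring

-- Signs of functionals on polynomials with nonnegative coefficients

NonNegCoeffs : Poly → Set
NonNegCoeffs = All (0ℚ ≤ℚ_)

⟨⟩-nonPos : ∀ {p f} → NonNegCoeffs p → (∀ k → f k ≤ℚ 0ℚ) → ⟨ p , f ⟩ ≤ℚ 0ℚ
⟨⟩-nonPos []          f≤0 = ℚP.≤-refl
⟨⟩-nonPos {a ∷ p} {f} (0≤a ∷ 0≤p) f≤0 =
  ℚP.+-mono-≤ (subst (a *ℚ f 0 ≤ℚ_) (ℚP.*-zeroʳ a)
                     (ℚP.*-monoˡ-≤-nonNeg a {{nonNegative 0≤a}} (f≤0 0)))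
              (⟨⟩-nonPos 0≤p (f≤0 ∘ suc))

⟨⟩-nonNeg : ∀ {p f} → NonNegCoeffs p → (∀ k → k < length p → 0ℚ <ℚ f k) → 0ℚ ≤ℚ ⟨ p , f ⟩
⟨⟩-nonNeg []          0<f = ℚP.≤-refl
⟨⟩-nonNeg (0≤a ∷ 0≤p) 0<f =
  ℚP.+-mono-≤ (0≤*ℚ 0≤a (ℚP.<⇒≤ (0<f 0 z<s))) (⟨⟩-nonNeg 0≤p (λ k → 0<f (suc k) ∘ s<s))

-- All summands are nonnegative, so a sum ≤ 0 makes each of them vanish, and a positive `f k` then
-- forces the coefficient to be zero. Positivity is asked only for `k < length p`; this is where a
-- degree bound enters.
⟨⟩-nonPos⇒zero : ∀ {p f} → NonNegCoeffs p → (∀ k → k < length p → 0ℚ <ℚ f k) →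
                 ⟨ p , f ⟩ ≤ℚ 0ℚ → p ≋ []
⟨⟩-nonPos⇒zero [] 0<f pf≤0 i = refl
⟨⟩-nonPos⇒zero {a ∷ p} {f} (0≤a ∷ 0≤p) 0<f pf≤0 = zeros
  where
  0<f′ : ∀ k → k < length p → 0ℚ <ℚ f (suc k)
  0<f′ k k< = 0<f (suc k) (s<s k<)
  0<f0 = 0<f 0 z<s
  0≤rest = ⟨⟩-nonNeg 0≤p 0<f′
  af0≤0 : a *ℚ f 0 ≤ℚ 0ℚ
  af0≤0 = ℚP.≤-trans (subst (_≤ℚ ⟨ a ∷ p , f ⟩) (ℚP.+-identityʳ _)
                            (ℚP.+-monoʳ-≤ (a *ℚ f 0) 0≤rest)) pf≤0
  a≤0 : a ≤ℚ 0ℚ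
  a≤0 = ℚP.*-cancelʳ-≤-pos (f 0) {{positive 0<f0}}
          (subst (a *ℚ f 0 ≤ℚ_) (sym (ℚP.*-zeroˡ (f 0))) af0≤0)
  rest≤0 : ⟨ p , f ∘ suc ⟩ ≤ℚ 0ℚ
  rest≤0 = ℚP.≤-trans (subst (_≤ℚ ⟨ a ∷ p , f ⟩) (ℚP.+-identityˡ _)
                         (ℚP.+-monoˡ-≤ ⟨ p , f ∘ suc ⟩ (0≤*ℚ 0≤a (ℚP.<⇒≤ 0<f0)))) pf≤0
  zeros : a ∷ p ≋ []
  zeros zero    = ℚP.≤-antisym a≤0 0≤a
  zeros (suc i) = ⟨⟩-nonPos⇒zero 0≤p 0<f′ rest≤0 i

-- The separating functional for multiples of G_n

ε⁻¹ : ℕ → ℕ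
ε⁻¹ n = 2 ^ 2 ^ (n + 1)

ε*ε⁻¹ : ∀ n → ε n *ℚ fromℕ (ε⁻¹ n) ≡ 1ℚ
ε*ε⁻¹ n = 1/n*n≡1 (ε⁻¹ n) {{ℕP.m^n≢0 2 (2 ^ (n + 1))}}

2^2^[1+n] : ∀ n → 2 ^ 2 ^ suc n ≡ 2 ^ 2 ^ n * 2 ^ 2 ^ n
2^2^[1+n] n = trans (cong (λ m → 2 ^ (2 ^ n + m)) (ℕP.+-identityʳ (2 ^ n)))
                    (ℕP.^-distribˡ-+-* 2 (2 ^ n) (2 ^ n))

ε⁻¹≡² : ∀ n → ε⁻¹ n ≡ 2 ^ 2 ^ n * 2 ^ 2 ^ n
ε⁻¹≡² n = trans (cong (λ m → 2 ^ 2 ^ m) (ℕP.+-comm n 1)) (2^2^[1+n] n)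

-- The concave sequence 2N² - k² with N² = 1/ε n: its second difference is -2,
-- so x^k G_n is sent to -2 + ε n (2N² - k²) = -ε n k² ≤ 0.
weight : ℕ → ℕ → ℚ
weight n k = fromℕ (2 * ε⁻¹ n) +ℚ -ℚ (fromℕ k *ℚ fromℕ k)

-- Squaring gives k² ≤ N² = `ε⁻¹ n`, which is strictly below `2 * ε⁻¹ n`.
weight-pos : ∀ n {k} → k ≤ 2 ^ 2 ^ n → 0ℚ <ℚ weight n k
weight-pos n {k} k≤N = subst (_<ℚ weight n k) (ℚP.+-inverseʳ (fromℕ k *ℚ fromℕ k))
  (ℚP.+-monoˡ-< (-ℚ (fromℕ k *ℚ fromℕ k)) k²<2M)
  where
  k*k<2M : k * k < 2 * ε⁻¹ n
  k*k<2M = ℕP.≤-<-trans (subst (k * k ≤_) (sym (ε⁻¹≡² n)) (ℕP.*-mono-≤ k≤N k≤N))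
             (ℕP.m<m+n (ε⁻¹ n) (ℕP.<-≤-trans (ℕP.m^n>0 2 (2 ^ (n + 1))) (ℕP.m≤m+n _ 0)))
  k²<2M : fromℕ k *ℚ fromℕ k <ℚ fromℕ (2 * ε⁻¹ n)
  k²<2M = subst (_<ℚ _) (fromℕ-* k k) (fromℕ-mono-< k*k<2M)

weight-G : ∀ n k → 1ℚ *ℚ Δ (Δ (weight n)) k +ℚ ε n *ℚ weight n k ≤ℚ 0ℚ
weight-G n k = subst (_≤ℚ 0ℚ) (sym eq) (ℚP.neg-antimono-≤ (0≤*ℚ 0≤ε (0≤*ℚ (0≤fromℕ k) (0≤fromℕ k))))
  where
  0≤ε : 0ℚ ≤ℚ ε n
  0≤ε = ℚP.nonNegative⁻¹ (ε n) {{ℚP.normalize-nonNeg 1 (ε⁻¹ n) {{ℕP.m^n≢0 2 (2 ^ (n + 1))}}}}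
  M = fromℕ (ε⁻¹ n)
  x = fromℕ k
  -- The left side is the goal unfolded, with `fromℕ (suc k)` reduced to `1ℚ +ℚ x`. The product
  -- `e *ℚ c` is kept apart because its value 2 depends on `ε n` being the inverse of `ε⁻¹ n`.
  identity : ∀ c x e →
    1ℚ *ℚ (-ℚ 1ℚ *ℚ (-ℚ 1ℚ *ℚ (c +ℚ -ℚ (x *ℚ x)) +ℚ
                      1ℚ *ℚ (c +ℚ -ℚ ((1ℚ +ℚ x) *ℚ (1ℚ +ℚ x)))) +ℚ
           1ℚ *ℚ (-ℚ 1ℚ *ℚ (c +ℚ -ℚ ((1ℚ +ℚ x) *ℚ (1ℚ +ℚ x))) +ℚ
                  1ℚ *ℚ (c +ℚ -ℚ ((1ℚ +ℚ (1ℚ +ℚ x)) *ℚ (1ℚ +ℚ (1ℚ +ℚ x)))))) +ℚ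
    e *ℚ (c +ℚ -ℚ (x *ℚ x)) ≡
    (e *ℚ c +ℚ -ℚ (1ℚ +ℚ 1ℚ)) +ℚ -ℚ (e *ℚ (x *ℚ x))
  identity = solve-∀ ℚ-ring
  ε*2M : ε n *ℚ fromℕ (2 * ε⁻¹ n) ≡ 1ℚ +ℚ 1ℚ
  ε*2M = trans (cong (ε n *ℚ_) (fromℕ-* 2 (ε⁻¹ n)))
           (trans (double (ε n) M) (cong₂ _+ℚ_ (ε*ε⁻¹ n) (ε*ε⁻¹ n)))
    where
    double : ∀ e m → e *ℚ ((1ℚ +ℚ (1ℚ +ℚ 0ℚ)) *ℚ m) ≡ e *ℚ m +ℚ e *ℚ m
    double = solve-∀ ℚ-ring
  eq : 1ℚ *ℚ Δ (Δ (weight n)) k +ℚ ε n *ℚ weight n k ≡ -ℚ (ε n *ℚ (x *ℚ x))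
  eq = trans (identity (fromℕ (2 * ε⁻¹ n)) x (ε n))
         (trans (cong (λ z → (z +ℚ -ℚ (1ℚ +ℚ 1ℚ)) +ℚ -ℚ (ε n *ℚ (x *ℚ x))) ε*2M)
                (ℚP.+-identityˡ _))

-- The functional is ≤ 0 on `G n *ₚ q`, hence on `p`, while the length bound leaves in `p` only
-- exponents k ≤ N, where the weight is positive.
G-multiple-zero : ∀ n {p q} → NonNegCoeffs p → NonNegCoeffs q → length p ≤ suc (2 ^ 2 ^ n) →
                  p ≈ G n *ₚ q → p ≋ []
G-multiple-zero n {p} {q} 0≤p 0≤q len p≈Gq =
  ⟨⟩-nonPos⇒zero 0≤p (λ k k< → weight-pos n (ℕP.≤-pred (ℕP.≤-trans k< len)))
    (subst (_≤ℚ 0ℚ) (sym (trans (⟨⟩-congˡ (weight n) p≈Gq) (⟨⟩-G n q (weight n))))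
           (⟨⟩-nonPos 0≤q (weight-G n)))

-- Degrees of subtraction-free circuits

NonNeg-+ₚ : ∀ {p q} → NonNegCoeffs p → NonNegCoeffs q → NonNegCoeffs (p +ₚ q)
NonNeg-+ₚ []          0≤q         = 0≤q
NonNeg-+ₚ (0≤a ∷ 0≤p) []          = 0≤a ∷ 0≤p
NonNeg-+ₚ (0≤a ∷ 0≤p) (0≤b ∷ 0≤q) = ℚP.+-mono-≤ 0≤a 0≤b ∷ NonNeg-+ₚ 0≤p 0≤q

NonNeg-·ₚ : ∀ {a p} → 0ℚ ≤ℚ a → NonNegCoeffs p → NonNegCoeffs (a ·ₚ p)
NonNeg-·ₚ 0≤a []          = []
NonNeg-·ₚ 0≤a (0≤b ∷ 0≤p) = 0≤*ℚ 0≤a 0≤b ∷ NonNeg-·ₚ 0≤a 0≤p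

NonNeg-*ₚ : ∀ {p q} → NonNegCoeffs p → NonNegCoeffs q → NonNegCoeffs (p *ₚ q)
NonNeg-*ₚ []          0≤q = []
NonNeg-*ₚ (0≤a ∷ 0≤p) 0≤q = NonNeg-+ₚ (NonNeg-·ₚ 0≤a 0≤q) (ℚP.≤-refl ∷ NonNeg-*ₚ 0≤p 0≤q)

length-+ₚ : ∀ {p q l} → length p ≤ l → length q ≤ l → length (p +ₚ q) ≤ l
length-+ₚ {[]}            p≤l       q≤l       = q≤l
length-+ₚ {a ∷ p} {[]}    p≤l       q≤l       = p≤l
length-+ₚ {a ∷ p} {b ∷ q} (s≤s p≤l) (s≤s q≤l) = s≤s (length-+ₚ {p} {q} p≤l q≤l)

length-*ₚ : ∀ p q {d e} → length p ≤ suc d → length q ≤ suc e → length (p *ₚ q) ≤ suc (d + e)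
length-*ₚ []          q         p≤ q≤ = z≤n
length-*ₚ (a ∷ p)     q {d} {e} (s≤s p≤) q≤ = length-+ₚ {a ·ₚ q}
  (subst (_≤ suc (d + e)) (sym (length-map (a *ℚ_) q)) (ℕP.≤-trans q≤ (s≤s (ℕP.m≤n+m e d))))
  (tail p p≤)
  where
  -- Bounds the shifted product. An empty tail is separated because there `d` may be 0 and has no
  -- predecessor to serve as a degree bound.
  tail : ∀ {d} p → length p ≤ d → suc (length (p *ₚ q)) ≤ suc (d + e)
  tail         []      p≤       = s≤s z≤n
  tail {suc d} (b ∷ p) (s≤s p≤) = s≤s (length-*ₚ (b ∷ p) q (s≤s p≤) q≤)

record NonNegBounded (d : ℕ) (p : Poly) : Set where
  constructor _,_
  field
    nonNeg  : NonNegCoeffs p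
    bounded : length p ≤ suc d
open NonNegBounded

bounded-+ₚ : ∀ {d p q} → NonNegBounded d p → NonNegBounded d q → NonNegBounded d (p +ₚ q)
bounded-+ₚ {d} {p} {q} (0≤p , p≤) (0≤q , q≤) = NonNeg-+ₚ 0≤p 0≤q , length-+ₚ {p} {q} p≤ q≤

bounded-*ₚ : ∀ {d e p q} → NonNegBounded d p → NonNegBounded e q → NonNegBounded (d + e) (p *ₚ q)
bounded-*ₚ {d} {e} {p} {q} (0≤p , p≤) (0≤q , q≤) = NonNeg-*ₚ 0≤p 0≤q , length-*ₚ p q p≤ q≤

bounded-weaken : ∀ {d e p} → d ≤ e → NonNegBounded d p → NonNegBounded e p
bounded-weaken d≤e (0≤p , p≤) = 0≤p , ℕP.≤-trans p≤ (s≤s d≤e)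

NonNegFraction : ℕ → RatFun → Set
NonNegFraction d u = NonNegBounded d (num u) × NonNegBounded d (den u)

-- Each new numerator or denominator is a product of one part of `u` and one part of `v`, or a sum
-- of two such products. With one bound for both parts of a fraction, degrees add at every gate,
-- even at a division.
apply-nonNeg : ∀ {o} → SubtractionFreeOp o → ∀ {d e u v} (def : Defined o v) →
  NonNegFraction d u → NonNegFraction e v → NonNegFraction (d + e) (apply o u v def)
apply-nonNeg add {d} {e} {u} {v} def (nu , du) (nv , dv) =
  bounded-+ₚ (bounded-*ₚ nu dv)
             (subst (λ k → NonNegBounded k (num v *ₚ den u)) (ℕP.+-comm e d) (bounded-*ₚ nv du)) ,
  bounded-*ₚ du dv
apply-nonNeg mul def (nu , du) (nv , dv) = bounded-*ₚ nu nv , bounded-*ₚ du dv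
apply-nonNeg div def (nu , du) (nv , dv) = bounded-*ₚ nu dv , bounded-*ₚ du nv

-- Both arguments of a gate may have the largest degree so far, so each gate doubles the bound; it
-- starts at 2^0 = 1, the degree of the variable.
value-nonNeg : ∀ {k} (N : Network subtractionFree k) a → NonNegFraction (2 ^ k) (value N a)
value-nonNeg {k} N var =
  (ℚP.≤-refl ∷ ℚP.nonNegative⁻¹ 1ℚ ∷ [] , s≤s (ℕP.m^n>0 2 k)) , (ℚP.nonNegative⁻¹ 1ℚ ∷ [] , s≤s z≤n)
value-nonNeg N (const _ (m , refl)) =
  (ℚP.nonNegative⁻¹ _ {{ℚP.normalize-nonNeg (suc m) 1}} ∷ [] , s≤s z≤n) , (ℚP.nonNegative⁻¹ 1ℚ ∷ [] , s≤s z≤n)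
value-nonNeg {suc k} (ext N o sf a b def) (gate zero) =
  subst (λ d → NonNegFraction d (apply o (value N a) (value N b) def))
    (cong (λ z → 2 ^ k + z) (sym (ℕP.+-identityʳ (2 ^ k))))
    (apply-nonNeg sf def (value-nonNeg N a) (value-nonNeg N b))
value-nonNeg {suc k} (ext N o sf a b def) (gate (suc i)) =
  let nu , de = value-nonNeg N (gate i)
  in bounded-weaken 2^k≤ nu , bounded-weaken 2^k≤ de
  where
  2^k≤ = ℕP.^-monoʳ-≤ 2 (ℕP.n≤1+n k)

G≉0 : ∀ n → ¬ (G n ≋ [])
-- The coefficient of x² does not involve `ε n` and reduces to a closed nonzero rational.
G≉0 n z with z 2
... | ()

-- With at most 2^n gates the numerator has degree at most 2^(2^n) = N, so `G-multiple-zero` makes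
-- it zero; but it equals `G n` times a nonzero denominator.
subtractionFreeLowerBound : ∀ n → Complexity> subtractionFree (ι (G n)) (2 ^ n)
subtractionFreeLowerBound n C C≃G = ℕP.≰⇒> λ size≤ →
  let nu , de = value-nonNeg (network C) (output C)
      -- The extra factor is the denominator 1 of `ι (G n)`, introduced by the cross-multiplication
      -- in `_≃_`; it has degree 0.
      nu₁ = bounded-*ₚ nu (ℚP.nonNegative⁻¹ 1ℚ ∷ [] , s≤s z≤n)
      degree≤ = subst (_≤ 2 ^ 2 ^ n) (sym (ℕP.+-identityʳ _)) (ℕP.^-monoʳ-≤ 2 size≤)
      p≋0 = G-multiple-zero n {q = den ⟦ C ⟧} (nonNeg nu₁) (nonNeg de)
              (ℕP.≤-trans (bounded nu₁) (s≤s degree≤)) (equal C≃G)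
  in *ₚ-nonZero (G n) (den ⟦ C ⟧) (G≉0 n) (den≉0 ⟦ C ⟧) λ i → trans (sym (C≃G i)) (p≋0 i)

-- Positive multiples of G n

module ≈-Reasoning where
  open import Relation.Binary.Reasoning.Setoid (CommutativeRing.setoid polyRing) public

κ : ℕ → Poly
κ n = constₚ (fromℕ n)

constₚ-* : ∀ a b → constₚ (a *ℚ b) ≈ constₚ a *ₚ constₚ b
constₚ-* a b = sym (ℚP.+-identityʳ (a *ℚ b)) ∷-cong ≈-refl

≈-reflexive : ∀ {p q} → p ≡ q → p ≈ q
≈-reflexive refl = ≈-refl

κ-+ : ∀ m n → κ (m + n) ≈ κ m +ₚ κ n
κ-+ m n = ≈-reflexive (cong constₚ (fromℕ-+ m n))

κ-* : ∀ m n → κ (m * n) ≈ κ m *ₚ κ n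
κ-* m n = ≈-trans (≈-reflexive (cong constₚ (fromℕ-* m n))) (constₚ-* (fromℕ m) (fromℕ n))

-- Subtraction-free polynomial expressions

infixl 6 _⊕_
infixl 7 _⊗_
-- There is no zero constant, so no expression denotes the zero polynomial, and each one translates
-- into a network without subtraction.
data PosPoly : Set where
  X       : PosPoly
  [1+_]   : ℕ → PosPoly
  _⊕_ _⊗_ : PosPoly → PosPoly → PosPoly

poly : PosPoly → Poly
poly X       = Xₚ
poly [1+ m ] = κ (suc m)
poly (s ⊕ t) = poly s +ₚ poly t
poly (s ⊗ t) = poly s *ₚ poly t

-- The constant sequence 1 gives evaluation at x = 1, which is multiplicative. Expressions in
-- `PosPoly` are positive there and therefore nonzero.
⟨⟩-1-* : ∀ p q → ⟨ p *ₚ q , (λ _ → 1ℚ) ⟩ ≡ ⟨ p , (λ _ → 1ℚ) ⟩ *ℚ ⟨ q , (λ _ → 1ℚ) ⟩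
⟨⟩-1-* []      q = sym (ℚP.*-zeroˡ ⟨ q , (λ _ → 1ℚ) ⟩)
⟨⟩-1-* (a ∷ p) q = trans (⟨⟩-*-∷ a p q (λ _ → 1ℚ))
  (trans (cong (a *ℚ ⟨ q , (λ _ → 1ℚ) ⟩ +ℚ_) (⟨⟩-1-* p q))
         (rearrange a ⟨ p , (λ _ → 1ℚ) ⟩ ⟨ q , (λ _ → 1ℚ) ⟩))
  where
  rearrange : ∀ a u v → a *ℚ v +ℚ u *ℚ v ≡ (a *ℚ 1ℚ +ℚ u) *ℚ v
  rearrange = solve-∀ ℚ-ring

⟨poly⟩-pos : ∀ s → 0ℚ <ℚ ⟨ poly s , (λ _ → 1ℚ) ⟩
⟨poly⟩-pos X       = ℚP.positive⁻¹ _
⟨poly⟩-pos [1+ m ] = subst (0ℚ <ℚ_) (sym (trans (ℚP.+-identityʳ _) (ℚP.*-identityʳ _)))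
                                    (fromℕ-mono-< {0} {suc m} z<s)
⟨poly⟩-pos (s ⊕ t) = subst (0ℚ <ℚ_) (sym (⟨⟩-+ (poly s) (poly t) _))
                                    (ℚP.+-mono-< (⟨poly⟩-pos s) (⟨poly⟩-pos t))
⟨poly⟩-pos (s ⊗ t) = subst (0ℚ <ℚ_) (sym (⟨⟩-1-* (poly s) (poly t))) (ℚP.positive⁻¹ (u *ℚ v)
  {{ℚP.pos*pos⇒pos u {{positive (⟨poly⟩-pos s)}} v {{positive (⟨poly⟩-pos t)}}}})
  where
  u = ⟨ poly s , (λ _ → 1ℚ) ⟩
  v = ⟨ poly t , (λ _ → 1ℚ) ⟩

poly≉0 : ∀ s → ¬ (poly s ≋ [])
poly≉0 s z = ℚP.<-irrefl (sym (⟨⟩-zero (poly s) _ z)) (⟨poly⟩-pos s)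

-- Some multiple of a y² - b y + c is subtraction-free (b moved to the left
-- so that a, b, c can be natural numbers).
PositiveMultiple : (a b c : ℕ) → PosPoly → Set
PositiveMultiple a b c y = ∃[ s ] ∃[ t ]
  poly s +ₚ κ b *ₚ poly y *ₚ poly t ≈ (κ a *ₚ (poly y *ₚ poly y) +ₚ κ c) *ₚ poly t

positiveMultiple-0 : ∀ a c y → PositiveMultiple (suc a) 0 (suc c) y
positiveMultiple-0 a c y = [1+ a ] ⊗ (y ⊗ y) ⊕ [1+ c ] , [1+ 0 ] , (begin
  p +ₚ κ 0 *ₚ v *ₚ κ 1         ≈⟨ +ₚ-cong (≈-refl {p}) (*ₚ-cong (*ₚ-cong 0∷[]≈[] (≈-refl {v})) (≈-refl {κ 1})) ⟩
  p +ₚ []                      ≈⟨ +ₚ-identityʳ p ⟩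
  p                            ≈⟨ *ₚ-identityˡ p ⟨
  1ₚ *ₚ p                      ≈⟨ *ₚ-comm 1ₚ p ⟩
  p *ₚ κ 1                     ∎)
  where
  open ≈-Reasoning
  v = poly y
  p = κ (suc a) *ₚ (v *ₚ v) +ₚ κ (suc c)

-- (a y² - b y + c) (a y² + b y + c) = a² y⁴ + (2 a c - b²) y² + c²
positiveMultiple-< : ∀ a b c e y → suc b * suc b + suc e ≡ suc a * suc c + suc a * suc c →
                     PositiveMultiple (suc a) (suc b) (suc c) y
positiveMultiple-< a b c e y eq =
  [1+ a ] ⊗ [1+ a ] ⊗ (y ⊗ y ⊗ (y ⊗ y)) ⊕ [1+ e ] ⊗ (y ⊗ y) ⊕ [1+ c ] ⊗ [1+ c ] ,
  [1+ a ] ⊗ (y ⊗ y) ⊕ [1+ b ] ⊗ y ⊕ [1+ c ] ,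
  ≈-trans (left α β γ η v)
 (≈-trans (+ₚ-cong (≈-refl {rest}) (*ₚ-cong coeffs (≈-refl {v *ₚ v})))
          (right α β γ v))
  where
  α = κ (suc a)
  β = κ (suc b)
  γ = κ (suc c)
  η = κ (suc e)
  v = poly y
  rest = α *ₚ α *ₚ (v *ₚ v *ₚ (v *ₚ v)) +ₚ γ *ₚ γ +ₚ α *ₚ β *ₚ (v *ₚ v *ₚ v) +ₚ β *ₚ γ *ₚ v
  open ≈-Reasoning
  coeffs : β *ₚ β +ₚ η ≈ α *ₚ γ +ₚ α *ₚ γ
  coeffs = begin
    β *ₚ β +ₚ η                              ≈⟨ +ₚ-cong (κ-* (suc b) (suc b)) (≈-refl {η}) ⟨
    κ (suc b * suc b) +ₚ η                   ≈⟨ κ-+ (suc b * suc b) (suc e) ⟨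
    κ (suc b * suc b + suc e)                ≡⟨ cong κ eq ⟩
    κ (suc a * suc c + suc a * suc c)        ≈⟨ κ-+ (suc a * suc c) (suc a * suc c) ⟩
    κ (suc a * suc c) +ₚ κ (suc a * suc c)   ≈⟨ +ₚ-cong (κ-* (suc a) (suc c)) (κ-* (suc a) (suc c)) ⟩
    α *ₚ γ +ₚ α *ₚ γ                         ∎
  left : ∀ α β γ η v →
    (α *ₚ α *ₚ (v *ₚ v *ₚ (v *ₚ v)) +ₚ η *ₚ (v *ₚ v) +ₚ γ *ₚ γ) +ₚ
      β *ₚ v *ₚ (α *ₚ (v *ₚ v) +ₚ β *ₚ v +ₚ γ) ≈
    (α *ₚ α *ₚ (v *ₚ v *ₚ (v *ₚ v)) +ₚ γ *ₚ γ +ₚ α *ₚ β *ₚ (v *ₚ v *ₚ v) +ₚ β *ₚ γ *ₚ v) +ₚ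
      (β *ₚ β +ₚ η) *ₚ (v *ₚ v)
  left = solve-∀ poly-ring
  right : ∀ α β γ v →
    (α *ₚ α *ₚ (v *ₚ v *ₚ (v *ₚ v)) +ₚ γ *ₚ γ +ₚ α *ₚ β *ₚ (v *ₚ v *ₚ v) +ₚ β *ₚ γ *ₚ v) +ₚ
      (α *ₚ γ +ₚ α *ₚ γ) *ₚ (v *ₚ v) ≈
    (α *ₚ (v *ₚ v) +ₚ γ) *ₚ (α *ₚ (v *ₚ v) +ₚ β *ₚ v +ₚ γ)
  right = solve-∀ poly-ring

-- Here b² ≥ 2 a c, so the Graeffe product is a quadratic in y² whose middle coefficient is again of
-- the form -e. A multiplier `t` for that quadratic becomes (a y² + b y + c) t for the original one.
positiveMultiple-step : ∀ a b c e y → suc a * suc c + suc a * suc c + e ≡ suc b * suc b →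
  PositiveMultiple (suc a * suc a) e (suc c * suc c) (y ⊗ y) →
  PositiveMultiple (suc a) (suc b) (suc c) y
positiveMultiple-step a b c e y eq (s , t , IH) =
  s , ([1+ a ] ⊗ (y ⊗ y) ⊕ [1+ b ] ⊗ y ⊕ [1+ c ]) ⊗ t , (begin
  p +ₚ β *ₚ v *ₚ ((α *ₚ (v *ₚ v) +ₚ β *ₚ v +ₚ γ) *ₚ q)
    ≈⟨ left α β γ v p q ⟩
  p +ₚ β *ₚ β *ₚ (v *ₚ v *ₚ q) +ₚ rest
    ≈⟨ +ₚ-cong (+ₚ-cong (≈-refl {p}) (*ₚ-cong coeffs (≈-refl {v *ₚ v *ₚ q}))) (≈-refl {rest}) ⟩
  p +ₚ (α *ₚ γ +ₚ α *ₚ γ +ₚ η) *ₚ (v *ₚ v *ₚ q) +ₚ rest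
    ≈⟨ middle (α *ₚ γ) η v p q rest ⟩
  p +ₚ η *ₚ (v *ₚ v) *ₚ q +ₚ rest₂
    ≈⟨ +ₚ-cong IH (≈-refl {rest₂}) ⟩
  (κ (suc a * suc a) *ₚ (v *ₚ v *ₚ (v *ₚ v)) +ₚ κ (suc c * suc c)) *ₚ q +ₚ rest₂
    ≈⟨ +ₚ-cong (*ₚ-cong (+ₚ-cong (*ₚ-cong (κ-* (suc a) (suc a)) (≈-refl {v *ₚ v *ₚ (v *ₚ v)}))
                                 (κ-* (suc c) (suc c)))
                        (≈-refl {q}))
               (≈-refl {rest₂}) ⟩
  (α *ₚ α *ₚ (v *ₚ v *ₚ (v *ₚ v)) +ₚ γ *ₚ γ) *ₚ q +ₚ rest₂
    ≈⟨ right α β γ v q ⟩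
  (α *ₚ (v *ₚ v) +ₚ γ) *ₚ ((α *ₚ (v *ₚ v) +ₚ β *ₚ v +ₚ γ) *ₚ q) ∎)
  where
  open ≈-Reasoning
  α = κ (suc a)
  β = κ (suc b)
  γ = κ (suc c)
  η = κ e
  v = poly y
  p = poly s
  q = poly t
  rest = β *ₚ v *ₚ (α *ₚ (v *ₚ v) +ₚ γ) *ₚ q
  rest₂ = (α *ₚ γ +ₚ α *ₚ γ) *ₚ (v *ₚ v *ₚ q) +ₚ rest
  coeffs : β *ₚ β ≈ α *ₚ γ +ₚ α *ₚ γ +ₚ η
  coeffs = begin
    β *ₚ β
      ≈⟨ κ-* (suc b) (suc b) ⟨
    κ (suc b * suc b)
      ≡⟨ cong κ eq ⟨
    κ (suc a * suc c + suc a * suc c + e)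
      ≈⟨ κ-+ (suc a * suc c + suc a * suc c) e ⟩
    κ (suc a * suc c + suc a * suc c) +ₚ η
      ≈⟨ +ₚ-cong (κ-+ (suc a * suc c) (suc a * suc c)) (≈-refl {η}) ⟩
    κ (suc a * suc c) +ₚ κ (suc a * suc c) +ₚ η
      ≈⟨ +ₚ-cong (+ₚ-cong (κ-* (suc a) (suc c)) (κ-* (suc a) (suc c))) (≈-refl {η}) ⟩
    α *ₚ γ +ₚ α *ₚ γ +ₚ η ∎
  left : ∀ α β γ v p q →
    p +ₚ β *ₚ v *ₚ ((α *ₚ (v *ₚ v) +ₚ β *ₚ v +ₚ γ) *ₚ q) ≈
    p +ₚ β *ₚ β *ₚ (v *ₚ v *ₚ q) +ₚ β *ₚ v *ₚ (α *ₚ (v *ₚ v) +ₚ γ) *ₚ q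
  left = solve-∀ poly-ring
  middle : ∀ δ η v p q r →
    p +ₚ (δ +ₚ δ +ₚ η) *ₚ (v *ₚ v *ₚ q) +ₚ r ≈
    p +ₚ η *ₚ (v *ₚ v) *ₚ q +ₚ ((δ +ₚ δ) *ₚ (v *ₚ v *ₚ q) +ₚ r)
  middle = solve-∀ poly-ring
  right : ∀ α β γ v q →
    (α *ₚ α *ₚ (v *ₚ v *ₚ (v *ₚ v)) +ₚ γ *ₚ γ) *ₚ q +ₚ
      ((α *ₚ γ +ₚ α *ₚ γ) *ₚ (v *ₚ v *ₚ q) +ₚ β *ₚ v *ₚ (α *ₚ (v *ₚ v) +ₚ γ) *ₚ q) ≈
    (α *ₚ (v *ₚ v) +ₚ γ) *ₚ ((α *ₚ (v *ₚ v) +ₚ β *ₚ v +ₚ γ) *ₚ q)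
  right = solve-∀ poly-ring

-- d is minus the discriminant.  Passing from (a, b, c) to (a², b² - 2 a c, c²)
-- replaces d by d b², so while b² ≥ 2 a c the ratio d / 4 a c at least doubles;
-- it starts at 2^-m or more and is at most 1 (only for b = 0), so m steps suffice.
positiveMultiple : ∀ m a b c d y →
  b * b + d ≡ 4 * (suc a * suc c) → 4 * (suc a * suc c) ≤ 2 ^ m * d →
  PositiveMultiple (suc a) b (suc c) y
positiveMultiple m       a zero      c d y disc bound = positiveMultiple-0 a c y
positiveMultiple zero    a b@(suc _) c d y disc bound =
  contradiction (subst (_≤ 1 * d) (sym disc) bound)
                (ℕP.<⇒≱ (subst (_< b * b + d) (sym (ℕP.+-identityʳ d)) (ℕP.m<n+m d z<s)))
positiveMultiple (suc m) a b@(suc b-1) c d y disc bound with suc a * suc c + suc a * suc c ℕP.≤? b * b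
... | no 2h≰b² =
  positiveMultiple-< a b-1 c _ y (trans (ℕP.+-suc (b * b) _) (ℕP.m+[n∸m]≡n (ℕP.≰⇒> 2h≰b²)))
... | yes 2h≤b² =
  positiveMultiple-step a b-1 c e y 2h+e≡b²
    -- The coefficients are passed as predecessors: `suc a * suc a` reduces to
    -- `suc (a + a * suc a)`, and likewise for `c`.
    (positiveMultiple m (a + a * suc a) e (c + c * suc c) (d * (b * b)) (y ⊗ y) disc′ bound′)
  where
  open ≡-Reasoning
  h = suc a * suc c
  e = b * b ∸ (h + h)
  2h+e≡b² : h + h + e ≡ b * b
  2h+e≡b² = ℕP.m+[n∸m]≡n 2h≤b²
  e+d≡2h : e + d ≡ h + h
  e+d≡2h = ℕP.+-cancelˡ-≡ (h + h) (e + d) (h + h) (begin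
    h + h + (e + d)  ≡⟨ ℕP.+-assoc (h + h) e d ⟨
    h + h + e + d    ≡⟨ cong (_+ d) 2h+e≡b² ⟩
    b * b + d        ≡⟨ disc ⟩
    4 * h            ≡⟨ four h ⟩
    h + h + (h + h)  ∎)
    where
    four : ∀ h → 4 * h ≡ h + h + (h + h)
    four = ℕ-Solver.solve-∀
  -- Substituting b² = 2 e + d turns the new discriminant equation into (e + d)² = (2 h)².
  e+d+e≡b² : e + d + e ≡ b * b
  e+d+e≡b² = trans (cong (_+ e) e+d≡2h) 2h+e≡b²
  disc′ : e * e + d * (b * b) ≡ 4 * (suc a * suc a * (suc c * suc c))
  disc′ = begin
    e * e + d * (b * b)                  ≡⟨ cong (λ z → e * e + d * z) e+d+e≡b² ⟨
    e * e + d * (e + d + e)              ≡⟨ square e d ⟩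
    (e + d) * (e + d)                    ≡⟨ cong₂ _*_ e+d≡2h e+d≡2h ⟩
    (h + h) * (h + h)                    ≡⟨ double (suc a) (suc c) ⟩
    4 * (suc a * suc a * (suc c * suc c))  ∎
    where
    square : ∀ e d → e * e + d * (e + d + e) ≡ (e + d) * (e + d)
    square = ℕ-Solver.solve-∀
    double : ∀ a c → (a * c + a * c) * (a * c + a * c) ≡ 4 * (a * a * (c * c))
    double = ℕ-Solver.solve-∀
  -- The old bound is multiplied by 2 h ≤ b², and a common factor 2 is cancelled.
  bound′ : 4 * (suc a * suc a * (suc c * suc c)) ≤ 2 ^ m * (d * (b * b))
  bound′ = ℕP.*-cancelˡ-≤ 2
    (subst₂ _≤_ (lhs (suc a) (suc c)) (rhs (2 ^ m) d (b * b)) (ℕP.*-mono-≤ bound 2h≤b²))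
    where
    lhs : ∀ a c → 4 * (a * c) * (a * c + a * c) ≡ 2 * (4 * (a * a * (c * c)))
    lhs = ℕ-Solver.solve-∀
    rhs : ∀ p d s → 2 * p * d * s ≡ 2 * (p * (d * s))
    rhs = ℕ-Solver.solve-∀

n<2^n : ∀ n → n < 2 ^ n
n<2^n zero    = z<s
n<2^n (suc n) = ℕP.+-mono-≤ (ℕP.m^n>0 2 n) (subst (suc n ≤_) (sym (ℕP.+-identityʳ (2 ^ n))) (n<2^n n))

[X-1]²+ : ℚ → Poly
[X-1]²+ e = (Xₚ -ₚ constₚ 1ℚ) *ₚ (Xₚ -ₚ constₚ 1ℚ) +ₚ constₚ e

-- With A = `suc a` = 1/e, multiplying (x - 1)² + e by A clears the denominator: A x² - 2 A x + (A +
-- 1), whose discriminant is -4 A. The factor A is absorbed into the multiplier.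
positiveMultiple-G : ∀ e a → e *ℚ fromℕ (suc a) ≡ 1ℚ →
  ∃[ s ] ∃[ t ] poly s ≈ [X-1]²+ e *ₚ poly t
positiveMultiple-G e a ea≡1 =
  -- The step count is A + 1: the starting ratio is 4 A / (4 A (A + 1)) = 1 / (A + 1), and A + 1 ≤
  -- 2^(A + 1).
  let s , t , eq = positiveMultiple (suc (suc a)) a (suc a + suc a) (suc a) (4 * suc a) X
                     (disc (suc a))
                     (subst (_≤ 2 ^ (2 + a) * (4 * suc a)) (swap (suc a))
                            (ℕP.*-monoˡ-≤ (4 * suc a) (ℕP.<⇒≤ (n<2^n (2 + a)))))
      p = poly s
      q = poly t
  in s , [1+ a ] ⊗ t , (begin
    p
      ≈⟨ isolate μ Xₚ p q ⟩
    p +ₚ (μ +ₚ μ) *ₚ Xₚ *ₚ q +ₚ -ₚ ((μ +ₚ μ) *ₚ Xₚ *ₚ q)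
      ≈⟨ +ₚ-cong (≈-trans (+ₚ-cong (≈-refl {p})
                                   (*ₚ-cong (*ₚ-cong (≈-sym (κ-+ (suc a) (suc a))) (≈-refl {Xₚ}))
                                            (≈-refl {q})))
                          eq)
                 (≈-refl { -ₚ ((μ +ₚ μ) *ₚ Xₚ *ₚ q)}) ⟩
    (μ *ₚ (Xₚ *ₚ Xₚ) +ₚ (1ₚ +ₚ μ)) *ₚ q +ₚ -ₚ ((μ +ₚ μ) *ₚ Xₚ *ₚ q)
      ≈⟨ +ₚ-cong (*ₚ-cong (+ₚ-cong (≈-refl {μ *ₚ (Xₚ *ₚ Xₚ)}) (+ₚ-cong 1≈eμ (≈-refl {μ})))
                          (≈-refl {q}))
                 (≈-refl { -ₚ ((μ +ₚ μ) *ₚ Xₚ *ₚ q)}) ⟩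
    (μ *ₚ (Xₚ *ₚ Xₚ) +ₚ (constₚ e *ₚ μ +ₚ μ)) *ₚ q +ₚ -ₚ ((μ +ₚ μ) *ₚ Xₚ *ₚ q)
      ≈⟨ factor μ Xₚ (constₚ e) q ⟩
    [X-1]²+ e *ₚ (μ *ₚ q) ∎)
  where
  open ≈-Reasoning
  μ = κ (suc a)
  1≈eμ : 1ₚ ≈ constₚ e *ₚ μ
  1≈eμ = ≈-trans (≈-reflexive (cong constₚ (sym ea≡1))) (constₚ-* e (fromℕ (suc a)))
  disc : ∀ A → (A + A) * (A + A) + 4 * A ≡ 4 * (A * suc A)
  disc = ℕ-Solver.solve-∀
  swap : ∀ A → suc A * (4 * A) ≡ 4 * (A * suc A)
  swap = ℕ-Solver.solve-∀
  -- The zero test of `poly-ring` accepts only `[]`, while cancelling coefficients leave `0ℚ ∷ []`;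
  -- hence the argument by hand.
  isolate : ∀ μ x p q → p ≈ p +ₚ (μ +ₚ μ) *ₚ x *ₚ q +ₚ -ₚ ((μ +ₚ μ) *ₚ x *ₚ q)
  isolate μ x p q = ≈-sym (begin
    p +ₚ r +ₚ -ₚ r      ≈⟨ +ₚ-assoc p r (-ₚ r) ⟩
    p +ₚ (r +ₚ -ₚ r)    ≈⟨ +ₚ-cong (≈-refl {p}) (CommutativeRing.-‿inverseʳ polyRing r) ⟩
    p +ₚ []             ≈⟨ +ₚ-identityʳ p ⟩
    p                   ∎)
    where r = (μ +ₚ μ) *ₚ x *ₚ q
  factor : ∀ μ x e q → (μ *ₚ (x *ₚ x) +ₚ (e *ₚ μ +ₚ μ)) *ₚ q +ₚ -ₚ ((μ +ₚ μ) *ₚ x *ₚ q) ≈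
                       ((x +ₚ -ₚ 1ₚ) *ₚ (x +ₚ -ₚ 1ₚ) +ₚ e) *ₚ (μ *ₚ q)
  factor = solve-∀ poly-ring

-- Circuits for polynomials

infix 4 _IsPoly_
-- Stronger than `u ≃ ι p`: with denominator 1 throughout, gates can be followed by congruence
-- alone, with no common factors to cancel.
record _IsPoly_ (u : RatFun) (p : Poly) : Set where
  constructor _,_
  field
    num≈ : num u ≈ p
    den≈ : den u ≈ 1ₚ
open _IsPoly_

IsPoly-+ : ∀ {u v p q} → u IsPoly p → v IsPoly q → u +ᵣ v IsPoly p +ₚ q
IsPoly-+ {u} {v} {p} {q} (nu , du) (nv , dv) =
  ≈-trans (+ₚ-cong (*ₚ-cong nu dv) (*ₚ-cong nv du)) (num-+ p q) ,
  ≈-trans (*ₚ-cong du dv) (*ₚ-identityˡ 1ₚ)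
  where
  num-+ : ∀ p q → p *ₚ 1ₚ +ₚ q *ₚ 1ₚ ≈ p +ₚ q
  num-+ = solve-∀ poly-ring

IsPoly-* : ∀ {u v p q} → u IsPoly p → v IsPoly q → u *ᵣ v IsPoly p *ₚ q
IsPoly-* (nu , du) (nv , dv) = *ₚ-cong nu nv , ≈-trans (*ₚ-cong du dv) (*ₚ-identityˡ 1ₚ)

IsPoly≄0 : ∀ {u p} → u IsPoly p → ¬ (p ≋ []) → ¬ (u ≃ 0ᵣ)
IsPoly≄0 {u} {p} (nu , _) p≉0 u≃0 = p≉0 (_≈_.at (begin
  p            ≈⟨ nu ⟨
  num u        ≈⟨ *ₚ-identityˡ (num u) ⟨
  1ₚ *ₚ num u  ≈⟨ *ₚ-comm 1ₚ (num u) ⟩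
  num u *ₚ 1ₚ  ≈⟨ equal u≃0 ⟩
  []           ∎))
  where open ≈-Reasoning

-- Extending networks

infix 4 _⊑_
-- Adding gates shifts the indices of the old ones; `lift` records the new position of each node, so
-- values computed earlier stay available.
record _⊑_ {B k l} (N : Network B k) (N′ : Network B l) : Set where
  field
    lift       : Node B k → Node B l
    value-lift : ∀ a → value N′ (lift a) ≡ value N a
open _⊑_

⊑-refl : ∀ {B k} {N : Network B k} → N ⊑ N
⊑-refl .lift a       = a
⊑-refl .value-lift a = refl

⊑-trans : ∀ {B k l m} {N : Network B k} {N′ : Network B l} {N″ : Network B m} →
          N ⊑ N′ → N′ ⊑ N″ → N ⊑ N″
⊑-trans e f .lift a       = f .lift (e .lift a)
⊑-trans e f .value-lift a = trans (f .value-lift (e .lift a)) (e .value-lift a)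

⊑-ext : ∀ {B k} {N : Network B k} {o g a b d} → N ⊑ ext N o g a b d
⊑-ext .lift var         = var
⊑-ext .lift (const c x) = const c x
⊑-ext .lift (gate i)    = gate (suc i)
⊑-ext .value-lift var         = refl
⊑-ext .value-lift (const c x) = refl
⊑-ext .value-lift (gate i)    = refl

record Realisation {B k} (N : Network B k) (p : Poly) : Set where
  field
    {gates}  : ℕ
    {result} : Network B gates
    extends  : N ⊑ result
    node     : Node B gates
    isPoly   : value result node IsPoly p
open Realisation

lift-isPoly : ∀ {B k l p} {N : Network B k} {N′ : Network B l} (e : N ⊑ N′) {a} →
              value N a IsPoly p → value N′ (e .lift a) IsPoly p
lift-isPoly {p = p} e {a} = subst (_IsPoly p) (sym (e .value-lift a))

-- Building on top of an arbitrary `N` lets the second operand start from the network of the first,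
-- so both operands end up in one network.
realise : ∀ s {k} (N : Network subtractionFree k) → Realisation N (poly s)
realise X       N = record { extends = ⊑-refl {N = N} ; node = var ; isPoly = ≈-refl , ≈-refl }
realise [1+ m ] N = record
  { extends = ⊑-refl {N = N}
  ; node    = const (fromℕ (suc m)) (m , sym (/1≡fromℕ (suc m)))
  ; isPoly  = ≈-refl , ≈-refl
  }
realise (s ⊕ t) N =
  let S = realise s N
      T = realise t (result S)
  in record
    { result  = ext (result T) add add (extends T .lift (node S)) (node T) tt
    ; extends = ⊑-trans (extends S) (⊑-trans (extends T) ⊑-ext)
    ; node    = gate zero
    ; isPoly  = IsPoly-+ (lift-isPoly (extends T) (isPoly S)) (isPoly T)
    }
realise (s ⊗ t) N =
  let S = realise s N
      T = realise t (result S)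
  in record
    { result  = ext (result T) mul mul (extends T .lift (node S)) (node T) tt
    ; extends = ⊑-trans (extends S) (⊑-trans (extends T) ⊑-ext)
    ; node    = gate zero
    ; isPoly  = IsPoly-* (lift-isPoly (extends T) (isPoly S)) (isPoly T)
    }

-- A single division gate after both expressions computes g as the quotient; it is legal because
-- `poly t` is nonzero.
finiteComplexity : ∀ {g} s t → poly s ≈ g *ₚ poly t → FiniteComplexity subtractionFree (ι g)
finiteComplexity {g} s t s≈gt =
  let S = realise s ∅
      T = realise t (result S)
      a = extends T .lift (node S)
      u = value (result T) a
      v = value (result T) (node T)
      nu , du = lift-isPoly (extends T) {node S} (isPoly S)
      nv , dv = isPoly T
  in record
    { network = ext (result T) div div a (node T) (IsPoly≄0 (isPoly T) (poly≉0 t))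
    ; output  = gate zero
    } , (begin
      num u *ₚ den v *ₚ 1ₚ     ≈⟨ *ₚ-cong (*ₚ-cong nu dv) (≈-refl {1ₚ}) ⟩
      poly s *ₚ 1ₚ *ₚ 1ₚ       ≈⟨ *ₚ-cong (*ₚ-cong s≈gt (≈-refl {1ₚ})) (≈-refl {1ₚ}) ⟩
      g *ₚ poly t *ₚ 1ₚ *ₚ 1ₚ  ≈⟨ rearrange g (poly t) ⟩
      g *ₚ (1ₚ *ₚ poly t)      ≈⟨ *ₚ-cong (≈-refl {g}) (*ₚ-cong du nv) ⟨
      g *ₚ (den u *ₚ num v)    ∎) ._≈_.at
  where
  open ≈-Reasoning
  rearrange : ∀ g q → g *ₚ q *ₚ 1ₚ *ₚ 1ₚ ≈ g *ₚ (1ₚ *ₚ q)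
  rearrange = solve-∀ poly-ring

subtractionFreeFinite : ∀ n → FiniteComplexity subtractionFree (ι (G n))
subtractionFreeFinite n =
  let s , t , eq = positiveMultiple-G (ε n) (pred (ε⁻¹ n)) ε*suc-pred
  in finiteComplexity {G n} s t eq
  where
  ε*suc-pred : ε n *ℚ fromℕ (suc (pred (ε⁻¹ n))) ≡ 1ℚ
  ε*suc-pred = trans
    (cong (λ m → ε n *ℚ fromℕ m) (ℕP.suc-pred (ε⁻¹ n) {{ℕP.m^n≢0 2 (2 ^ (n + 1))}}))
    (ε*ε⁻¹ n)

-- Upper bounds for circuits with subtraction

ordinaryUpperBound : ∀ n → Complexity≤ ordinary (ι (G n)) 3
ordinaryUpperBound n =
  record
    { network = ext (ext (ext ∅ sub tt var (const 1ℚ tt) tt)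
                         mul tt (gate zero) (gate zero) tt)
                    add tt (gate zero) (const (ε n) tt) tt
    ; output  = gate zero
    } ,
  computes Xₚ (constₚ (ε n)) ._≈_.at ,
  ℕP.≤-refl
  where
  -- The factors `1ₚ` are the unreduced denominators accumulated by the three gates.
  computes : ∀ x e →
    (((x *ₚ 1ₚ -ₚ 1ₚ *ₚ 1ₚ) *ₚ (x *ₚ 1ₚ -ₚ 1ₚ *ₚ 1ₚ)) *ₚ 1ₚ +ₚ
      e *ₚ ((1ₚ *ₚ 1ₚ) *ₚ (1ₚ *ₚ 1ₚ))) *ₚ 1ₚ ≈
    ((x -ₚ 1ₚ) *ₚ (x -ₚ 1ₚ) +ₚ e) *ₚ (((1ₚ *ₚ 1ₚ) *ₚ (1ₚ *ₚ 1ₚ)) *ₚ 1ₚ)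
  computes = solve-∀ poly-ring

-- Repeated squaring from 1 + 1 = 2 reaches 2^(2^k); for k = n + 1 this is the reciprocal of `ε n`.
squarings : ∀ k → Network ordinaryFrom1 (suc k)
squarings zero    = ext ∅ add tt (const 1ℚ refl) (const 1ℚ refl) tt
squarings (suc k) = ext (squarings k) mul tt (gate zero) (gate zero) tt

squarings-isPoly : ∀ k → value (squarings k) (gate zero) IsPoly κ (2 ^ 2 ^ k)
squarings-isPoly zero    = IsPoly-+ {ι 1ₚ} {ι 1ₚ} {1ₚ} {1ₚ} (≈-refl , ≈-refl) (≈-refl , ≈-refl)
squarings-isPoly (suc k) =
  let nu , du = IsPoly-* (squarings-isPoly k) (squarings-isPoly k)
  in (begin
       num (value (squarings (suc k)) (gate zero))  ≈⟨ nu ⟩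
       κ (2 ^ 2 ^ k) *ₚ κ (2 ^ 2 ^ k)               ≈⟨ κ-* (2 ^ 2 ^ k) (2 ^ 2 ^ k) ⟨
       κ (2 ^ 2 ^ k * 2 ^ 2 ^ k)                    ≡⟨ cong κ (2^2^[1+n] k) ⟨
       κ (2 ^ 2 ^ suc k)                            ∎) , du
  where open ≈-Reasoning

from1UpperBound : ∀ n → 1 ≤ n → Complexity≤ ordinaryFrom1 (ι (G n)) (7 * n)
from1UpperBound n 1≤n =
  record
    { network = ext (ext (ext (ext (squarings (n + 1))
                                   div tt (const 1ℚ refl) (gate zero) v≄0)
                              sub tt var (const 1ℚ refl) tt)
                         mul tt (gate zero) (gate zero) tt)
                    -- Counting back from here: the square, the difference x - 1, then the quotient
                    -- equal to `ε n`.
                    add tt (gate zero) (gate (suc (suc zero))) tt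
    ; output  = gate zero
    } ,
  computes ._≈_.at ,
  size≤
  where
  open ≈-Reasoning
  v = value (squarings (n + 1)) (gate zero)
  e = constₚ (ε n)
  v-isPoly = squarings-isPoly (n + 1)
  κ≉0 : ¬ (κ (ε⁻¹ n) ≋ [])
  κ≉0 z = ℚP.<-irrefl (sym (z 0)) (fromℕ-mono-< (ℕP.m^n>0 2 (2 ^ (n + 1))))
  v≄0 : ¬ (v ≃ 0ᵣ)
  v≄0 = IsPoly≄0 v-isPoly κ≉0
  -- Expressing `den v` through `num v` leaves the latter as a free variable in `rearrange`, so the
  -- final identity needs no further fact about `ε n`.
  den-v : den v ≈ e *ₚ num v
  den-v = begin
    den v                           ≈⟨ den≈ v-isPoly ⟩
    1ₚ                              ≡⟨ cong constₚ (ε*ε⁻¹ n) ⟨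
    constₚ (ε n *ℚ fromℕ (ε⁻¹ n))   ≈⟨ constₚ-* (ε n) (fromℕ (ε⁻¹ n)) ⟩
    e *ₚ κ (ε⁻¹ n)                  ≈⟨ *ₚ-cong (≈-refl {e}) (num≈ v-isPoly) ⟨
    e *ₚ num v                      ∎
  rearrange : ∀ x e m →
    (((x *ₚ 1ₚ -ₚ 1ₚ *ₚ 1ₚ) *ₚ (x *ₚ 1ₚ -ₚ 1ₚ *ₚ 1ₚ)) *ₚ (1ₚ *ₚ m) +ₚ
      (1ₚ *ₚ (e *ₚ m)) *ₚ ((1ₚ *ₚ 1ₚ) *ₚ (1ₚ *ₚ 1ₚ))) *ₚ 1ₚ ≈
    ((x -ₚ 1ₚ) *ₚ (x -ₚ 1ₚ) +ₚ e) *ₚ (((1ₚ *ₚ 1ₚ) *ₚ (1ₚ *ₚ 1ₚ)) *ₚ (1ₚ *ₚ m))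
  rearrange = solve-∀ poly-ring
  s² = (Xₚ *ₚ 1ₚ -ₚ 1ₚ *ₚ 1ₚ) *ₚ (Xₚ *ₚ 1ₚ -ₚ 1ₚ *ₚ 1ₚ)
  dens = (1ₚ *ₚ 1ₚ) *ₚ (1ₚ *ₚ 1ₚ)
  computes : (s² *ₚ (1ₚ *ₚ num v) +ₚ (1ₚ *ₚ den v) *ₚ dens) *ₚ 1ₚ ≈ G n *ₚ (dens *ₚ (1ₚ *ₚ num v))
  computes = ≈-trans
    (*ₚ-cong (+ₚ-cong (≈-refl {s² *ₚ (1ₚ *ₚ num v)})
                      (*ₚ-cong (*ₚ-cong (≈-refl {1ₚ}) den-v) (≈-refl {dens})))
             (≈-refl {1ₚ}))
    (rearrange Xₚ e (num v))
  -- The size is n + 6, and 6 ≤ 6 n because n ≥ 1.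
  size≤ : 4 + suc (n + 1) ≤ 7 * n
  size≤ = subst₂ _≤_ (lhs n) (rhs n) (ℕP.+-monoʳ-≤ n (ℕP.*-monoʳ-≤ 6 1≤n))
    where
    lhs : ∀ n → n + 6 * 1 ≡ 4 + suc (n + 1)
    lhs = ℕ-Solver.solve-∀
    rhs : ∀ n → n + 6 * n ≡ 7 * n
    rhs = ℕ-Solver.solve-∀

proposition8p3 : ((n : ℕ) → 1 ≤ n →
    FiniteComplexity subtractionFree (ι (G n)) ×
    Complexity> subtractionFree (ι (G n)) (2 ^ n))
    × (∃[ K ] ((n : ℕ) → 1 ≤ n → Complexity≤ ordinary (ι (G n)) K))
    × (∃[ K ] ((n : ℕ) → 1 ≤ n → Complexity≤ ordinaryFrom1 (ι (G n)) (K * n)))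
proposition8p3 =
  (λ n _ → subtractionFreeFinite n , subtractionFreeLowerBound n) ,
  (3 , λ n _ → ordinaryUpperBound n) ,
  (7 , from1UpperBound)
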